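{- Let $B\ge 1$ be an integer. For every $\varepsilon>0$ there exists $m_0$ such that for every $m\ge m_0$, every (deterministic) fractional online algorithm for the packet buffering problem with $m$ buffers, each of size $B$, has competitive ratio at least $\frac{e}{e-1}-\varepsilon$. In other words, the competitive ratio of any fractional algorithm is at least $e/(e-1)$, for any value of $B$ and $m\to\infty$.
   Context: Packet buffering problem (unweighted FIFO buffer management): there are $m$ buffers, each able to store up to $B$ unit-size, unit-value packets; all buffers are initially empty. An input $\sigma$ is a finite sequence of injections: at each integer time $t\ge 0$ an arbitrary (integral, possibly zero) number of packets is injected into each buffer. Packets exceeding the capacity $B$ of a buffer are lost; injection is instantaneous. Then, during the step $(t,t+1)$, an algorithm in the standard (integral) model may transmit a single packet from one non-empty buffer of its choice. After the last injection the algorithm has sufficient time to transmit all packets remaining in its buffers. The throughput $T_A(\sigma)$ of an algorithm $A$ on $\sigma$ is the total number of packets it transmits. OPT is the optimal offline integral algorithm (it knows $\sigma$ in advance and maximizes throughput). Fractional model: a fractional algorithm is deterministic and keeps a real load in $[0,B]$ in each buffer. Injecting $p$ packets into a buffer of load $x$ changes the load to $\min(B,x+p)$. In each step it may transmit arbitrary non-negative real amounts from the buffers (at most the current load from each buffer), of total at most 1. Its throughput is the total load transmitted. Injected packets are still integral and injected at integer times. An algorithm is online if its decision in step $(t,t+1)$ depends only on the injections up to and including time $t$. The competitive ratio of an online algorithm ALG is $\sup_\sigma T_{\mathrm{OPT}}(\sigma)/T_{\mathrm{ALG}}(\sigma)$ over all inputs $\sigma$ containing at least one packet, where OPT is the integral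 optimum. -}

module Defs where

open import Data.Empty using (⊥-elim)
open import Data.Fin.Base using (Fin)
open import Data.Integer.Base using (+_)
import Data.Integer.Base as ℤ
import Data.Integer.Properties as ℤ
open import Data.List.Base using (List; []; _∷_)
import Data.List.Relation.Unary.Any as List
open import Data.Maybe.Base using (Maybe; just; nothing)
open import Data.Nat.Base as ℕ using (ℕ; zero; suc; _!; s≤s)
import Data.Nat.Properties as ℕ
open import Data.Product using (∃-syntax; _×_; _,_)
open import Data.Rational.Base as ℚ using (ℚ; mkℚ; 0ℚ; 1ℚ; ½)
import Data.Rational.Properties as ℚ
open import Data.Rational.Solver using () renaming (module +-*-Solver to S)
import Data.Rational.Unnormalised.Base as ℚᵘ
import Data.Rational.Unnormalised.Properties as ℚᵘ
open import Data.Sum.Base using (inj₁; inj₂)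
open import Data.Vec.Base using (Vec; lookup; replicate)
import Data.Vec.Functional as Vector
import Data.Vec.Relation.Unary.Any as Vec
open import Relation.Binary.PropositionalEquality
open import Relation.Nullary using (yes; no)

-- Reals are Cauchy sequences of rationals.  All operations are pointwise,
-- and equality of reals is mutual _≤ᵣ_, never propositional equality.

IsCauchy : (ℕ → ℚ) → Set
IsCauchy s = ∀ ε → 0ℚ ℚ.< ε →
  ∃[ N ] (∀ m n → N ℕ.≤ m → N ℕ.≤ n → ℚ.∣ s m ℚ.- s n ∣ ℚ.< ε)

record ℝ : Set where
  constructor mkℝ
  field
    seq    : ℕ → ℚ
    cauchy : IsCauchy seq

open ℝ public

infix 4 _<ᵣ_ _≤ᵣ_

_<ᵣ_ : ℝ → ℝ → Set
x <ᵣ y = ∃[ δ ] (0ℚ ℚ.< δ × ∃[ N ] (∀ n → N ℕ.≤ n → seq x n ℚ.+ δ ℚ.≤ seq y n))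

_≤ᵣ_ : ℝ → ℝ → Set
x ≤ᵣ y = ∀ δ → 0ℚ ℚ.< δ → ∃[ N ] (∀ n → N ℕ.≤ n → seq x n ℚ.≤ seq y n ℚ.+ δ)

abstract
  0<½ : 0ℚ ℚ.< ½
  0<½ = ℚ.positive⁻¹ ½

  *-pos : ∀ {p q} → 0ℚ ℚ.< p → 0ℚ ℚ.< q → 0ℚ ℚ.< p ℚ.* q
  *-pos {p} {q} 0<p 0<q =
    ℚ.positive⁻¹ _ {{ℚ.pos*pos⇒pos p {{ℚ.positive 0<p}} q {{ℚ.positive 0<q}}}}

  half-pos : ∀ {ε} → 0ℚ ℚ.< ε → 0ℚ ℚ.< ε ℚ.* ½
  half-pos 0<ε = *-pos 0<ε 0<½

  half+half : ∀ ε → ε ℚ.* ½ ℚ.+ ε ℚ.* ½ ≡ ε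
  half+half ε = trans (sym (ℚ.*-distribˡ-+ ε ½ ½)) (ℚ.*-identityʳ ε)

  p≤∣p∣ : ∀ p → p ℚ.≤ ℚ.∣ p ∣
  p≤∣p∣ p with ℚ.≤-total 0ℚ p
  ... | inj₁ 0≤p = ℚ.≤-reflexive (sym (ℚ.0≤p⇒∣p∣≡p 0≤p))
  ... | inj₂ p≤0 = ℚ.≤-trans p≤0 (ℚ.0≤∣p∣ p)

  ∣-∣-sym : ∀ p q → ℚ.∣ p ℚ.- q ∣ ≡ ℚ.∣ q ℚ.- p ∣
  ∣-∣-sym p q = trans (cong ℚ.∣_∣ (S.solve 2 (λ a b → a S.:- b S.:= S.:- (b S.:- a)) refl p q))
                      (ℚ.∣-p∣≡∣p∣ (q ℚ.- p))

  shift : ∀ {p q r} → p ℚ.- q ℚ.< r → p ℚ.< q ℚ.+ r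
  shift {p} {q} {r} lt =
    subst (ℚ._< q ℚ.+ r) (S.solve 2 (λ a b → b S.:+ (a S.:- b) S.:= a) refl p q)
          (ℚ.+-monoʳ-< q lt)

  unshift : ∀ {p q r} → p ℚ.< q ℚ.+ r → p ℚ.- q ℚ.< r
  unshift {p} {q} {r} lt =
    subst (p ℚ.- q ℚ.<_) (S.solve 2 (λ b c → (b S.:+ c) S.:- b S.:= c) refl q r)
          (ℚ.+-monoˡ-< (ℚ.- q) lt)

  dist⇒< : ∀ {p q ε} → ℚ.∣ p ℚ.- q ∣ ℚ.< ε → p ℚ.< q ℚ.+ ε
  dist⇒< {p} {q} d = shift {p} {q} (ℚ.≤-<-trans (p≤∣p∣ (p ℚ.- q)) d)

  <⇒dist : ∀ {p q ε} → p ℚ.< q ℚ.+ ε → q ℚ.< p ℚ.+ ε → ℚ.∣ p ℚ.- q ∣ ℚ.< ε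
  <⇒dist {p} {q} {ε} p< q< with ℚ.∣p∣≡p∨∣p∣≡-p (p ℚ.- q)
  ... | inj₁ eq = subst (ℚ._< ε) (sym eq) (unshift {p} {q} p<)
  ... | inj₂ eq = subst (ℚ._< ε)
    (sym (trans eq (S.solve 2 (λ a b → S.:- (a S.:- b) S.:= b S.:- a) refl p q)))
    (unshift {q} {p} q<)

  +-cauchy : ∀ s t → IsCauchy s → IsCauchy t → IsCauchy (λ n → s n ℚ.+ t n)
  +-cauchy s t cs ct ε 0<ε =
    let N₁ , h₁ = cs (ε ℚ.* ½) (half-pos 0<ε)
        N₂ , h₂ = ct (ε ℚ.* ½) (half-pos 0<ε)
    in N₁ ℕ.⊔ N₂ , λ m n N≤m N≤n →
      let d₁ = h₁ m n (ℕ.m⊔n≤o⇒m≤o N₁ N₂ N≤m) (ℕ.m⊔n≤o⇒m≤o N₁ N₂ N≤n)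
          d₂ = h₂ m n (ℕ.m⊔n≤o⇒n≤o N₁ N₂ N≤m) (ℕ.m⊔n≤o⇒n≤o N₁ N₂ N≤n)
          eq = S.solve 4 (λ a b c d → (a S.:+ b) S.:- (c S.:+ d) S.:= (a S.:- c) S.:+ (b S.:- d))
                       refl (s m) (t m) (s n) (t n)
      in subst₂ ℚ._<_ (cong ℚ.∣_∣ (sym eq)) (half+half ε)
           (ℚ.≤-<-trans (ℚ.∣p+q∣≤∣p∣+∣q∣ (s m ℚ.- s n) (t m ℚ.- t n)) (ℚ.+-mono-< d₁ d₂))

  neg-cauchy : ∀ s → IsCauchy s → IsCauchy (λ n → ℚ.- s n)
  neg-cauchy s cs ε 0<ε =
    let N , h = cs ε 0<ε
    in N , λ m n N≤m N≤n →
      subst (ℚ._< ε)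
        (trans (∣-∣-sym (s m) (s n))
               (cong ℚ.∣_∣ (S.solve 2 (λ a b → b S.:- a S.:= S.:- a S.:- (S.:- b)) refl (s m) (s n))))
        (h m n N≤m N≤n)

  ⊓-cauchy : ∀ s t → IsCauchy s → IsCauchy t → IsCauchy (λ n → s n ℚ.⊓ t n)
  ⊓-cauchy s t cs ct ε 0<ε =
    let N₁ , h₁ = cs ε 0<ε
        N₂ , h₂ = ct ε 0<ε
        below : ∀ m n → N₁ ℕ.⊔ N₂ ℕ.≤ m → N₁ ℕ.⊔ N₂ ℕ.≤ n →
                s m ℚ.⊓ t m ℚ.< s n ℚ.⊓ t n ℚ.+ ε
        below m n N≤m N≤n =
          let d₁ = dist⇒< {s m} {s n} (h₁ m n (ℕ.m⊔n≤o⇒m≤o N₁ N₂ N≤m) (ℕ.m⊔n≤o⇒m≤o N₁ N₂ N≤n))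
              d₂ = dist⇒< {t m} {t n} (h₂ m n (ℕ.m⊔n≤o⇒n≤o N₁ N₂ N≤m) (ℕ.m⊔n≤o⇒n≤o N₁ N₂ N≤n))
              b₁ = ℚ.≤-<-trans (ℚ.p⊓q≤p (s m) (t m)) d₁
              b₂ = ℚ.≤-<-trans (ℚ.p⊓q≤q (s m) (t m)) d₂
          in cases (s n) (t n) b₁ b₂
    in N₁ ℕ.⊔ N₂ , λ m n N≤m N≤n →
      <⇒dist {s m ℚ.⊓ t m} {s n ℚ.⊓ t n} (below m n N≤m N≤n) (below n m N≤n N≤m)
    where
    cases : ∀ {a} p q → a ℚ.< p ℚ.+ ε → a ℚ.< q ℚ.+ ε → a ℚ.< p ℚ.⊓ q ℚ.+ ε
    cases {a} p q a<p a<q with ℚ.≤-total p q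
    ... | inj₁ p≤q = subst (λ r → a ℚ.< r ℚ.+ ε) (sym (ℚ.p≤q⇒p⊓q≡p p≤q)) a<p
    ... | inj₂ q≤p = subst (λ r → a ℚ.< r ℚ.+ ε) (sym (ℚ.p≥q⇒p⊓q≡q q≤p)) a<q

-- The reciprocal of 0 is set to 0; only the tail of a sequence that is
-- bounded away from 0 matters below.

recip : ℚ → ℚ
recip q with q ℚ.≟ 0ℚ
... | yes _  = 0ℚ
... | no q≢0 = ℚ.1/_ q {{ℚ.≢-nonZero q≢0}}

recip-inverse : ∀ q → 0ℚ ℚ.< q → q ℚ.* recip q ≡ 1ℚ
recip-inverse q 0<q with q ℚ.≟ 0ℚ
... | yes q≡0 = ⊥-elim (ℚ.<-irrefl (sym q≡0) 0<q)
... | no q≢0  = ℚ.*-inverseʳ q {{ℚ.≢-nonZero q≢0}}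

recip-pos : ∀ q → 0ℚ ℚ.< q → 0ℚ ℚ.< recip q
recip-pos q 0<q with q ℚ.≟ 0ℚ
... | yes q≡0 = ⊥-elim (ℚ.<-irrefl (sym q≡0) 0<q)
... | no q≢0  = ℚ.positive⁻¹ _ {{ℚ.1/pos⇒pos q {{ℚ.positive 0<q}}}}

abstract
  *-monoˡ : ∀ {p q} r → 0ℚ ℚ.≤ r → p ℚ.≤ q → r ℚ.* p ℚ.≤ r ℚ.* q
  *-monoˡ r 0≤r = ℚ.*-monoˡ-≤-nonNeg r {{ℚ.nonNegative 0≤r}}

  *-monoʳ : ∀ {p q} r → 0ℚ ℚ.≤ r → p ℚ.≤ q → p ℚ.* r ℚ.≤ q ℚ.* r
  *-monoʳ r 0≤r = ℚ.*-monoʳ-≤-nonNeg r {{ℚ.nonNegative 0≤r}}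

  *-mono-strictˡ : ∀ {p q} r → 0ℚ ℚ.< r → p ℚ.< q → r ℚ.* p ℚ.< r ℚ.* q
  *-mono-strictˡ r 0<r = ℚ.*-monoʳ-<-pos r {{ℚ.positive 0<r}}

  eventually-bounded : ∀ s → IsCauchy s →
    ∃[ K ] (0ℚ ℚ.< K × ∃[ N ] (∀ n → N ℕ.≤ n → ℚ.∣ s n ∣ ℚ.≤ K))
  eventually-bounded s cs =
    let N , h = cs 1ℚ (ℚ.positive⁻¹ 1ℚ)
    in 1ℚ ℚ.+ ℚ.∣ s N ∣
     , ℚ.<-≤-trans (ℚ.positive⁻¹ 1ℚ)
         (subst (ℚ._≤ 1ℚ ℚ.+ ℚ.∣ s N ∣) (ℚ.+-identityʳ 1ℚ) (ℚ.+-monoʳ-≤ 1ℚ (ℚ.0≤∣p∣ (s N))))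
     , N , λ n N≤n →
       ℚ.≤-trans
         (subst (λ r → ℚ.∣ r ∣ ℚ.≤ ℚ.∣ s n ℚ.- s N ∣ ℚ.+ ℚ.∣ s N ∣)
           (S.solve 2 (λ a b → (a S.:- b) S.:+ b S.:= a) refl (s n) (s N))
           (ℚ.∣p+q∣≤∣p∣+∣q∣ (s n ℚ.- s N) (s N)))
         (ℚ.<⇒≤ (ℚ.+-monoˡ-< ℚ.∣ s N ∣ (h n N N≤n ℕ.≤-refl)))

  scaled : ∀ {K} ε → 0ℚ ℚ.< K → K ℚ.* (ε ℚ.* recip K) ≡ ε
  scaled {K} ε 0<K = trans
    (S.solve 3 (λ k e r → k S.:* (e S.:* r) S.:= e S.:* (k S.:* r)) refl K ε (recip K))
    (trans (cong (ε ℚ.*_) (recip-inverse K 0<K)) (ℚ.*-identityʳ ε))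

  *-cauchy : ∀ s t → IsCauchy s → IsCauchy t → IsCauchy (λ n → s n ℚ.* t n)
  *-cauchy s t cs ct ε 0<ε =
    let K , 0<K , M₁ , bs = eventually-bounded s cs
        L , 0<L , M₂ , bt = eventually-bounded t ct
        h = ε ℚ.* ½
        0<h = half-pos 0<ε
        N₁ , ds = cs (h ℚ.* recip L) (*-pos 0<h (recip-pos L 0<L))
        N₂ , dt = ct (h ℚ.* recip K) (*-pos 0<h (recip-pos K 0<K))
        M = M₁ ℕ.⊔ M₂
        N = N₁ ℕ.⊔ N₂
        bound : ∀ m n → M ℕ.⊔ N ℕ.≤ m → M ℕ.⊔ N ℕ.≤ n →
                ℚ.∣ s m ℚ.* t m ℚ.- s n ℚ.* t n ∣ ℚ.< ε
        bound m n ≤m ≤n =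
          let M≤m = ℕ.m⊔n≤o⇒m≤o M N ≤m ; N≤m = ℕ.m⊔n≤o⇒n≤o M N ≤m
              M≤n = ℕ.m⊔n≤o⇒m≤o M N ≤n ; N≤n = ℕ.m⊔n≤o⇒n≤o M N ≤n
              Δs = s m ℚ.- s n
              Δt = t m ℚ.- t n
              b₁ : ℚ.∣ s m ℚ.* Δt ∣ ℚ.< h
              b₁ = subst (ℚ._< h) (sym (ℚ.∣p*q∣≡∣p∣*∣q∣ (s m) Δt))
                     (ℚ.≤-<-trans
                       (*-monoʳ ℚ.∣ Δt ∣ (ℚ.0≤∣p∣ Δt) (bs m (ℕ.m⊔n≤o⇒m≤o M₁ M₂ M≤m)))
                       (subst (K ℚ.* ℚ.∣ Δt ∣ ℚ.<_) (scaled h 0<K)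
                         (*-mono-strictˡ K 0<K
                           (dt m n (ℕ.m⊔n≤o⇒n≤o N₁ N₂ N≤m) (ℕ.m⊔n≤o⇒n≤o N₁ N₂ N≤n)))))
              b₂ : ℚ.∣ t n ℚ.* Δs ∣ ℚ.< h
              b₂ = subst (ℚ._< h) (sym (ℚ.∣p*q∣≡∣p∣*∣q∣ (t n) Δs))
                     (ℚ.≤-<-trans
                       (*-monoʳ ℚ.∣ Δs ∣ (ℚ.0≤∣p∣ Δs) (bt n (ℕ.m⊔n≤o⇒n≤o M₁ M₂ M≤n)))
                       (subst (L ℚ.* ℚ.∣ Δs ∣ ℚ.<_) (scaled h 0<L)
                         (*-mono-strictˡ L 0<L
                           (ds m n (ℕ.m⊔n≤o⇒m≤o N₁ N₂ N≤m) (ℕ.m⊔n≤o⇒m≤o N₁ N₂ N≤n)))))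
              eq = S.solve 4 (λ a b c d → a S.:* b S.:- c S.:* d S.:=
                                          a S.:* (b S.:- d) S.:+ d S.:* (a S.:- c))
                           refl (s m) (t m) (s n) (t n)
          in subst₂ ℚ._<_ (cong ℚ.∣_∣ (sym eq)) (half+half ε)
               (ℚ.≤-<-trans (ℚ.∣p+q∣≤∣p∣+∣q∣ (s m ℚ.* Δt) (t n ℚ.* Δs)) (ℚ.+-mono-< b₁ b₂))
    in M ℕ.⊔ N , bound

  recip-cauchy : ∀ s → IsCauchy s → ∀ δ → 0ℚ ℚ.< δ → ∀ N₀ → (∀ n → N₀ ℕ.≤ n → δ ℚ.≤ s n) →
                 IsCauchy (λ n → recip (s n))
  recip-cauchy s cs δ 0<δ N₀ δ≤s ε 0<ε =
    let r = recip δ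
        0<r = recip-pos δ 0<δ
        ε′ = (ε ℚ.* δ) ℚ.* δ
        N₁ , h = cs ε′ (*-pos (*-pos 0<ε 0<δ) 0<δ)
        r² = r ℚ.* r
        r²ε′ : r² ℚ.* ε′ ≡ ε
        r²ε′ = trans
          (S.solve 3 (λ r e d → (r S.:* r) S.:* ((e S.:* d) S.:* d) S.:=
                                e S.:* ((d S.:* r) S.:* (d S.:* r))) refl r ε δ)
          (trans (cong (λ u → ε ℚ.* (u ℚ.* u)) (recip-inverse δ 0<δ)) (ℚ.*-identityʳ ε))
        bound : ∀ m n → N₀ ℕ.⊔ N₁ ℕ.≤ m → N₀ ℕ.⊔ N₁ ℕ.≤ n →
                ℚ.∣ recip (s m) ℚ.- recip (s n) ∣ ℚ.< ε
        bound m n N≤m N≤n =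
          let a = s m ; b = s n
              δ≤a = δ≤s m (ℕ.m⊔n≤o⇒m≤o N₀ N₁ N≤m)
              δ≤b = δ≤s n (ℕ.m⊔n≤o⇒m≤o N₀ N₁ N≤n)
              0<a = ℚ.<-≤-trans 0<δ δ≤a
              0<b = ℚ.<-≤-trans 0<δ δ≤b
              ra = recip a ; rb = recip b
              0<ra = recip-pos a 0<a ; 0<rb = recip-pos b 0<b
              prod≤ : ra ℚ.* rb ℚ.≤ r²
              prod≤ = ℚ.≤-trans (*-monoʳ rb (ℚ.<⇒≤ 0<rb) (antitone a 0<a δ≤a))
                                (*-monoˡ r (ℚ.<⇒≤ 0<r) (antitone b 0<b δ≤b))
              eq : ra ℚ.- rb ≡ (ra ℚ.* rb) ℚ.* (b ℚ.- a)
              eq = sym (trans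
                (S.solve 4 (λ a b x y → (x S.:* y) S.:* (b S.:- a) S.:=
                                        x S.:* (b S.:* y) S.:- y S.:* (a S.:* x)) refl a b ra rb)
                (cong₂ ℚ._-_
                  (trans (cong (ra ℚ.*_) (recip-inverse b 0<b)) (ℚ.*-identityʳ ra))
                  (trans (cong (rb ℚ.*_) (recip-inverse a 0<a)) (ℚ.*-identityʳ rb))))
              abs≡ : ℚ.∣ ra ℚ.- rb ∣ ≡ (ra ℚ.* rb) ℚ.* ℚ.∣ b ℚ.- a ∣
              abs≡ = trans (cong ℚ.∣_∣ eq)
                (trans (ℚ.∣p*q∣≡∣p∣*∣q∣ (ra ℚ.* rb) (b ℚ.- a))
                  (cong (ℚ._* ℚ.∣ b ℚ.- a ∣) (ℚ.0≤p⇒∣p∣≡p (ℚ.<⇒≤ (*-pos 0<ra 0<rb)))))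
          in subst (ℚ._< ε) (sym abs≡)
               (ℚ.≤-<-trans (*-monoʳ ℚ.∣ b ℚ.- a ∣ (ℚ.0≤∣p∣ (b ℚ.- a)) prod≤)
                 (subst (r² ℚ.* ℚ.∣ b ℚ.- a ∣ ℚ.<_) r²ε′
                   (*-mono-strictˡ r² (*-pos 0<r 0<r)
                     (h n m (ℕ.m⊔n≤o⇒n≤o N₀ N₁ N≤n) (ℕ.m⊔n≤o⇒n≤o N₀ N₁ N≤m)))))
    in N₀ ℕ.⊔ N₁ , bound
    where
    antitone : ∀ a → 0ℚ ℚ.< a → δ ℚ.≤ a → recip a ℚ.≤ recip δ
    antitone a 0<a δ≤a =
      let ra = recip a ; r = recip δ
          u = ra ℚ.* r
          0≤u = ℚ.<⇒≤ (*-pos (recip-pos a 0<a) (recip-pos δ 0<δ))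
      in subst₂ ℚ._≤_
           (trans (S.solve 3 (λ x r d → (x S.:* r) S.:* d S.:= x S.:* (d S.:* r)) refl ra r δ)
             (trans (cong (ra ℚ.*_) (recip-inverse δ 0<δ)) (ℚ.*-identityʳ ra)))
           (trans (S.solve 3 (λ x r a → (x S.:* r) S.:* a S.:= r S.:* (a S.:* x)) refl ra r a)
             (trans (cong (r ℚ.*_) (recip-inverse a 0<a)) (ℚ.*-identityʳ r)))
           (*-monoˡ u 0≤u δ≤a)

infixl 6 _+ᵣ_ _-ᵣ_
infixl 7 _*ᵣ_ _⊓ᵣ_

fromℚ : ℚ → ℝ
fromℚ q = mkℝ (λ _ → q) λ ε 0<ε → 0 , λ _ _ _ _ →
  subst (ℚ._< ε) (cong ℚ.∣_∣ (sym (ℚ.+-inverseʳ q))) 0<ε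

fromℕ : ℕ → ℝ
fromℕ n = fromℚ (+ n ℚ./ 1)

0ᵣ 1ᵣ : ℝ
0ᵣ = fromℚ 0ℚ
1ᵣ = fromℚ 1ℚ

_+ᵣ_ : ℝ → ℝ → ℝ
x +ᵣ y = mkℝ (λ n → seq x n ℚ.+ seq y n) (+-cauchy (seq x) (seq y) (cauchy x) (cauchy y))

_-ᵣ_ : ℝ → ℝ → ℝ
x -ᵣ y = mkℝ (λ n → seq x n ℚ.- seq y n)
  (+-cauchy (seq x) (λ n → ℚ.- seq y n) (cauchy x) (neg-cauchy (seq y) (cauchy y)))

_*ᵣ_ : ℝ → ℝ → ℝ
x *ᵣ y = mkℝ (λ n → seq x n ℚ.* seq y n) (*-cauchy (seq x) (seq y) (cauchy x) (cauchy y))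

_⊓ᵣ_ : ℝ → ℝ → ℝ
x ⊓ᵣ y = mkℝ (λ n → seq x n ℚ.⊓ seq y n) (⊓-cauchy (seq x) (seq y) (cauchy x) (cauchy y))

1/ᵣ : (x : ℝ) → 0ᵣ <ᵣ x → ℝ
1/ᵣ x (δ , 0<δ , N , h) = mkℝ (λ n → recip (seq x n))
  (recip-cauchy (seq x) (cauchy x) δ 0<δ N
    λ n N≤n → subst (ℚ._≤ seq x n) (ℚ.+-identityˡ δ) (h n N≤n))

sumᵣ : ∀ {m} → (Fin m → ℝ) → ℝ
sumᵣ = Vector.foldr _+ᵣ_ 0ᵣ

invFact : ℕ → ℚ
invFact k = ((+ 1) ℚ./ (k !)) {{k ℕ.!≢0}}

expSum : ℕ → ℚ
expSum zero    = 0ℚ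
expSum (suc n) = expSum n ℚ.+ invFact n

abstract
  invFact-pos : ∀ k → 0ℚ ℚ.< invFact k
  invFact-pos k = ℚ.positive⁻¹ _ {{ℚ.normalize-pos 1 (k !) {{k ℕ.!≢0}}}}

  n≤n! : ∀ n → n ℕ.≤ n !
  n≤n! zero    = ℕ.z≤n
  n≤n! (suc n) = subst (ℕ._≤ suc n !) (ℕ.*-identityʳ (suc n)) (ℕ.*-monoʳ-≤ (suc n) (ℕ.1≤n! n))

  double-unit-fraction : ∀ a b .{{_ : ℕ.NonZero a}} .{{_ : ℕ.NonZero b}} → 2 ℕ.* b ℕ.≤ a →
    (+ 1) ℚ./ a ℚ.+ (+ 1) ℚ./ a ℚ.≤ (+ 1) ℚ./ b
  double-unit-fraction a@(suc a-1) b@(suc b-1) 2b≤a = ℚ.toℚᵘ-cancel-≤ (begin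
    ℚ.toℚᵘ (u ℚ.+ u)                          ≃⟨ ℚ.toℚᵘ-homo-+ u u ⟩
    ℚ.toℚᵘ u ℚᵘ.+ ℚ.toℚᵘ u                    ≃⟨ ℚᵘ.+-cong (ℚ.toℚᵘ-fromℚᵘ (ℚᵘ.mkℚᵘ (+ 1) a-1))
                                                           (ℚ.toℚᵘ-fromℚᵘ (ℚᵘ.mkℚᵘ (+ 1) a-1)) ⟩
    ℚᵘ.mkℚᵘ (+ 1) a-1 ℚᵘ.+ ℚᵘ.mkℚᵘ (+ 1) a-1  ≤⟨ ℚᵘ.*≤* (ℤ.+≤+ ineq) ⟩
    ℚᵘ.mkℚᵘ (+ 1) b-1                         ≃⟨ ℚᵘ.≃-sym (ℚ.toℚᵘ-fromℚᵘ (ℚᵘ.mkℚᵘ (+ 1) b-1)) ⟩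
    ℚ.toℚᵘ ((+ 1) ℚ./ b)                      ∎)
    where
    open ℚᵘ.≤-Reasoning
    u : ℚ
    u = (+ 1) ℚ./ a
    ineq : (1 ℕ.* a ℕ.+ 1 ℕ.* a) ℕ.* b ℕ.≤ 1 ℕ.* (a ℕ.* a)
    ineq = subst₂ ℕ._≤_
      (trans (sym (ℕ.*-assoc a 2 b)) (cong (ℕ._* b)
        (trans (ℕ.*-comm a 2) (cong₂ ℕ._+_ (sym (ℕ.*-identityˡ a)) refl))))
      (sym (ℕ.*-identityˡ (a ℕ.* a)))
      (ℕ.*-monoʳ-≤ a 2b≤a)

  2invFact : ℕ → ℚ
  2invFact k = invFact k ℚ.+ invFact k

  2invFact-step : ∀ k → 1 ℕ.≤ k → 2invFact (suc k) ℚ.≤ invFact k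
  2invFact-step k 1≤k =
    double-unit-fraction (suc k !) (k !) {{suc k ℕ.!≢0}} {{k ℕ.!≢0}} (ℕ.*-monoˡ-≤ (k !) (s≤s 1≤k))

  unit-fraction-below : ∀ ε → 0ℚ ℚ.< ε → ∃[ d ] (((+ 1) ℚ./ suc d) ℚ.< ε)
  unit-fraction-below ε@(mkℚ (+ zero) d _)    0<ε = ⊥-elim (ℚ.<-irrefl (sym (ℚ.↥p≡0⇒p≡0 ε refl)) 0<ε)
  unit-fraction-below ε@(mkℚ (ℤ.-[1+ n ]) d _) 0<ε = ⊥-elim (ℚ.<-asym 0<ε (ℚ.negative⁻¹ ε))
  unit-fraction-below ε@(mkℚ (+ suc p) d _)   0<ε = suc d , ℚ.toℚᵘ-cancel-<
    (ℚᵘ.<-respˡ-≃ (ℚᵘ.≃-sym (ℚ.toℚᵘ-fromℚᵘ (ℚᵘ.mkℚᵘ (+ 1) (suc d))))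
      (ℚᵘ.*<* (ℤ.+<+ (subst (ℕ._< suc p ℕ.* suc (suc d)) (sym (ℕ.*-identityˡ (suc d)))
        (ℕ.m≤m+n (suc (suc d)) (p ℕ.* suc (suc d)))))))

  p≤p+q : ∀ p {q} → 0ℚ ℚ.≤ q → p ℚ.≤ p ℚ.+ q
  p≤p+q p {q} 0≤q = subst (ℚ._≤ p ℚ.+ q) (ℚ.+-identityʳ p) (ℚ.+-monoʳ-≤ p 0≤q)

  expSum-lower′ : ∀ N j → expSum N ℚ.≤ expSum (j ℕ.+ N)
  expSum-lower′ N zero    = ℚ.≤-refl
  expSum-lower′ N (suc j) =
    ℚ.≤-trans (expSum-lower′ N j) (p≤p+q _ (ℚ.<⇒≤ (invFact-pos (j ℕ.+ N))))

  expSum-lower : ∀ {N n} → N ℕ.≤ n → expSum N ℚ.≤ expSum n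
  expSum-lower {N} {n} N≤n = subst (λ k → expSum N ℚ.≤ expSum k) (ℕ.m∸n+n≡m N≤n) (expSum-lower′ N (n ℕ.∸ N))

  expSum-upper′ : ∀ N → 1 ℕ.≤ N → ∀ j →
    expSum (j ℕ.+ N) ℚ.+ 2invFact (j ℕ.+ N) ℚ.≤ expSum N ℚ.+ 2invFact N
  expSum-upper′ N 1≤N zero    = ℚ.≤-refl
  expSum-upper′ N 1≤N (suc j) = ℚ.≤-trans
    (subst (expSum (suc k) ℚ.+ 2invFact (suc k) ℚ.≤_) (ℚ.+-assoc (expSum k) (invFact k) (invFact k))
      (ℚ.+-monoʳ-≤ (expSum (suc k)) (2invFact-step k (ℕ.≤-trans 1≤N (ℕ.m≤n+m N j)))))
    (expSum-upper′ N 1≤N j)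
    where
    k : ℕ
    k = j ℕ.+ N

  expSum-upper : ∀ {N n} → 1 ℕ.≤ N → N ℕ.≤ n → expSum n ℚ.≤ expSum N ℚ.+ 2invFact N
  expSum-upper {N} {n} 1≤N N≤n = ℚ.≤-trans
    (p≤p+q (expSum n) (ℚ.<⇒≤ (ℚ.+-mono-< (invFact-pos n) (invFact-pos n))))
    (subst (λ k → expSum k ℚ.+ 2invFact k ℚ.≤ expSum N ℚ.+ 2invFact N) (ℕ.m∸n+n≡m N≤n)
      (expSum-upper′ N 1≤N (n ℕ.∸ N)))

  expSum-cauchy : IsCauchy expSum
  expSum-cauchy ε 0<ε =
    let d , 1/d<ε = unit-fraction-below ε 0<ε
        N = 2 ℕ.* suc d
        2t<ε = ℚ.≤-<-trans (double-unit-fraction (N !) (suc d) {{N ℕ.!≢0}} (n≤n! N)) 1/d<ε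
        below : ∀ m n → N ℕ.≤ m → N ℕ.≤ n → expSum m ℚ.< expSum n ℚ.+ ε
        below m n N≤m N≤n = ℚ.≤-<-trans (expSum-upper (s≤s ℕ.z≤n) N≤m)
                                        (ℚ.+-mono-≤-< (expSum-lower N≤n) 2t<ε)
    in N , λ m n N≤m N≤n → <⇒dist {expSum m} {expSum n} (below m n N≤m N≤n) (below n m N≤n N≤m)

e : ℝ
e = mkℝ expSum expSum-cauchy

abstract
  2≤expSum : ∀ {n} → 2 ℕ.≤ n → 1ℚ ℚ.+ 1ℚ ℚ.≤ expSum n
  2≤expSum {n} 2≤n = subst (ℚ._≤ expSum n) expSum-2 (expSum-lower 2≤n)
    where
    expSum-2 : expSum 2 ≡ 1ℚ ℚ.+ 1ℚ
    expSum-2 = cong (ℚ._+ invFact 1) (ℚ.+-identityˡ (invFact 0))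

  subtract : ∀ u p → u ℚ.+ u ℚ.≤ p → 0ℚ ℚ.+ u ℚ.≤ p ℚ.- u
  subtract u p 2u≤p = subst (ℚ._≤ p ℚ.- u)
    (S.solve 1 (λ u → (u S.:+ u) S.:- u S.:= S.con 0ℚ S.:+ u) refl u)
    (ℚ.+-monoˡ-≤ (ℚ.- u) 2u≤p)

0<e-1 : 0ᵣ <ᵣ e -ᵣ 1ᵣ
0<e-1 = 1ℚ , ℚ.positive⁻¹ 1ℚ , 2 , λ n 2≤n → subtract 1ℚ (expSum n) (2≤expSum 2≤n)

e/[e-1] : ℝ
e/[e-1] = e *ᵣ 1/ᵣ (e -ᵣ 1ᵣ) 0<e-1

-- The numbers of packets injected into the m buffers at one time.
Injection : ℕ → Set
Injection m = Vec ℕ m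

-- The t-th entry is injected at time t; nothing is injected afterwards.
Input : ℕ → Set
Input m = List (Injection m)

HasPacket : ∀ {m} → Input m → Set
HasPacket = List.Any (Vec.Any (0 ℕ.<_))

injection : ∀ {m} → Input m → ℕ → Injection m
injection {m} []      t       = replicate m 0
injection     (p ∷ σ) zero    = p
injection     (p ∷ σ) (suc t) = injection σ t

-- The injections at times 0, …, t - 1, most recent first.
past : ∀ {m} → Input m → ℕ → List (Injection m)
past σ zero    = []
past σ (suc t) = injection σ t ∷ past σ t

-- policy p h i is the amount transmitted from buffer i in the step that
-- follows injection p, when the earlier injections were h (most recent
-- first).  That the algorithm is online and deterministic is built into
-- this type.
Policy : ℕ → Set
Policy m = Injection m → List (Injection m) → Fin m → ℝ

module _ {m : ℕ} (B : ℕ) (policy : Policy m) where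

  mutual
    -- Load of each buffer after injecting p.
    load : Injection m → List (Injection m) → Fin m → ℝ
    load p h i = fromℕ B ⊓ᵣ (residual h i +ᵣ fromℕ (lookup p i))

    -- Load of each buffer after the step that follows the latest
    -- injection of h.
    residual : List (Injection m) → Fin m → ℝ
    residual []      i = 0ᵣ
    residual (p ∷ h) i = load p h i -ᵣ policy p h i

record FractionalAlgorithm (m B : ℕ) : Set where
  field
    policy      : Policy m
    nonNegative : ∀ p h i → 0ᵣ ≤ᵣ policy p h i
    available   : ∀ p h i → policy p h i ≤ᵣ load B policy p h i
    total≤1     : ∀ p h → sumᵣ (policy p h) ≤ᵣ 1ᵣ

open FractionalAlgorithm public

transmitted : ∀ {m B} → FractionalAlgorithm m B → Input m → ℕ → ℝ
transmitted A σ zero    = 0ᵣ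
transmitted A σ (suc n) = transmitted A σ n +ᵣ sumᵣ (policy A (injection σ n) (past σ n))

-- The throughput is the supremum of transmitted A σ n over n, so this says
-- that it is at most x.  (Its value need not be a computable real.)
Throughput≤ : ∀ {m B} → FractionalAlgorithm m B → Input m → ℝ → Set
Throughput≤ A σ x = ∀ n → transmitted A σ n ≤ᵣ x

-- In step t, serve the buffer s t, or idle.  Serving an empty buffer is the
-- same as idling.
Schedule : ℕ → Set
Schedule m = ℕ → Maybe (Fin m)

serve : ∀ {m} → Maybe (Fin m) → (Fin m → ℕ) → Fin m → ℕ
serve nothing  q = q
serve (just i) q = Vector.updateAt q i ℕ.pred

served : ∀ {m} → Maybe (Fin m) → (Fin m → ℕ) → ℕ
served nothing  q = 0
served (just i) q = 1 ℕ.⊓ q i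

module _ {m : ℕ} (B : ℕ) (s : Schedule m) (σ : Input m) where

  mutual
    -- Queue lengths right after the injection at time t.
    queue : ℕ → Fin m → ℕ
    queue t i = B ℕ.⊓ (left t i ℕ.+ lookup (injection σ t) i)

    -- Queue lengths right before the injection at time t.
    left : ℕ → Fin m → ℕ
    left zero    i = 0
    left (suc t) i = serve (s t) (queue t) i

  sent : ℕ → ℕ
  sent zero    = 0
  sent (suc n) = sent n ℕ.+ served (s n) (queue n)

-- The throughput of s is the supremum of sent B s σ n over n.  It is attained,
-- being a bounded supremum of naturals, so T is the optimal throughput.
IsOptimum : ∀ {m} → ℕ → Input m → ℕ → Set
IsOptimum B σ T =
    (∃[ s ] ∃[ n ] sent B s σ n ≡ T)
  × (∀ s n → sent B s σ n ℕ.≤ T)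

-- q < T_OPT(σ) / T_A(σ), for q ≥ 0.  Multiplying out makes the ratio
-- infinite when T_A(σ) = 0 < T_OPT(σ).
RatioExceeds : ∀ {m B} → FractionalAlgorithm m B → Input m → ℝ → Set
RatioExceeds {B = B} A σ q =
  ∃[ x ] ∃[ T ] (Throughput≤ A σ x × IsOptimum B σ T × q *ᵣ x <ᵣ fromℕ T)

-- The supremum of T_OPT(σ) / T_A(σ) over inputs with at least one packet is
-- at least r: every q < r is exceeded by some ratio.
CompetitiveRatio≥ : ∀ {m B} → FractionalAlgorithm m B → ℝ → Set
CompetitiveRatio≥ A r = ∀ q → q <ᵣ r → ∃[ σ ] (HasPacket σ × RatioExceeds A σ q)

{-# OPTIONS --safe #-}
module Submission where

-- A set of n full buffers is attacked recursively.  To go one level deeper,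
-- attack the whole set at the current level, wait until n / K buffers could be
-- emptied, let the offline schedule turn out to have emptied the block of n / K
-- buffers in which the algorithm has the largest load, refill this block, and
-- attack it at the current level.  The offline schedule never loses a packet,
-- whereas an algorithm that has lowered its loads evenly by ℓ profits from only
-- an ℓ-th of each refill.  In units of nB the time f of an attack satisfies
-- f′ = 1 + f, so f = (1 + 1/K)^k - 1 after k levels, and the amount accepted by
-- the algorithm (sent or still stored) exceeds f by at most 1 - k (1/K) (1 - 1/K).
-- After k = K levels this excess is 1/K.  So with E = (1 + 1/K)^K the offline
-- schedule sends E and the algorithm at most E - 1 + 1/K, up to the error made in
-- choosing blocks by comparing reals, and E ≤ e yields e / (e - 1) in the limit.
-- K ^ K buffers are enough; the others stay empty.

open import Data.Bool.Base using (if_then_else_)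
open import Data.Empty using (⊥-elim)
open import Data.Fin.Base using (Fin; zero; suc)
import Data.Fin.Properties as Fin
import Data.Integer.Base as ℤ
import Data.Integer.Properties as ℤ
open import Data.List.Base using (List; []; _∷_; _∷ʳ_; _++_; allFin; drop; length; map; replicate; reverse; tabulate; take)
open import Data.List.Membership.DecPropositional using (_∈?_)
open import Data.List.Membership.Propositional using (_∈_; _∉_)
import Data.List.Membership.Propositional.Properties as ∈
import Data.List.Properties as List
open import Data.List.Relation.Binary.Permutation.Propositional using (_↭_; ↭-reflexive; ↭-sym; ↭-trans; ↭⇒↭ₛ)
import Data.List.Relation.Binary.Permutation.Propositional as ↭
import Data.List.Relation.Binary.Permutation.Propositional.Properties as ↭
import Data.List.Relation.Binary.Permutation.Setoid.Properties as ↭ₛ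
import Data.List.Relation.Unary.All as All
import Data.List.Relation.Unary.All.Properties as All
open import Data.List.Relation.Unary.AllPairs using ([]; _∷_)
import Data.List.Relation.Unary.Any as List
import Data.List.Relation.Unary.Any.Properties as List
open import Data.List.Relation.Unary.Any using (here; there)
open import Data.List.Relation.Unary.Unique.Propositional using (Unique)
open import Data.List.Relation.Unary.Unique.Propositional.Properties using (allFin⁺)
open import Data.Maybe.Base using (Maybe; just; nothing)
open import Data.Nat.Base as ℕ using (ℕ; zero; suc; _≤_; _!; z≤n; s≤s)
import Data.Nat.Properties as ℕ
open import Data.Nat.Solver using () renaming (module +-*-Solver to Sℕ)
open import Data.Product using (∃-syntax; _×_; _,_; proj₁; proj₂)
open import Data.Rational.Base as ℚ using (ℚ; 0ℚ; 1ℚ; ½; _+_; _*_; _-_)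
import Data.Rational.Properties as ℚ
open import Data.Rational.Solver using () renaming (module +-*-Solver to S)
import Data.Rational.Unnormalised.Base as ℚᵘ
import Data.Rational.Unnormalised.Properties as ℚᵘ
open import Data.Sum.Base using (_⊎_; inj₁; inj₂; [_,_]′)
open import Data.Unit.Base using (⊤; tt)
open import Data.Vec.Base using (lookup; []; _∷_) renaming (replicate to replicateᵛ; tabulate to tabulateᵛ)
open import Data.Vec.Functional using (updateAt)
open import Data.Vec.Functional.Properties using (updateAt-minimal; updateAt-updates)
import Data.Vec.Properties as Vec
import Data.Vec.Relation.Unary.Any as Vec
open import Function.Base using (_∘_; id)
open import Relation.Binary.PropositionalEquality
open import Relation.Nullary using (yes; no; does)
open import Relation.Nullary.Decidable using (dec-true; dec-false)
open import Defs

open import Algebra.Properties.CommutativeMonoid.Sum ℕ.+-0-commutativeMonoid using (sum; sum-cong-≗; sum-replicate-zero; ∑-distrib-+)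
open import Algebra.Properties.CommutativeSemigroup ℕ.+-commutativeSemigroup using (x∙yz≈y∙xz)

-- Natural numbers as rationals

abstract
  -- Abstract, so that numerals stay folded in the algebra below; `ι-def` leads back to the form
  -- used in `fromℕ`.
  ι : ℕ → ℚ
  ι n = ℤ.+ n ℚ./ 1

  ι-def : ∀ n → ι n ≡ ℤ.+ n ℚ./ 1
  ι-def n = refl

  ιᵘ : ∀ n → ℚ.toℚᵘ (ι n) ℚᵘ.≃ ℚᵘ.mkℚᵘ (ℤ.+ n) 0
  ιᵘ n = ℚ.toℚᵘ-fromℚᵘ (ℚᵘ.mkℚᵘ (ℤ.+ n) 0)

  ι-+ : ∀ m n → ι (m ℕ.+ n) ≡ ι m + ι n
  ι-+ m n = ℚ.toℚᵘ-injective (begin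
    ℚ.toℚᵘ (ι (m ℕ.+ n))                     ≈⟨ ιᵘ (m ℕ.+ n) ⟩
    ℚᵘ.mkℚᵘ (ℤ.+ (m ℕ.+ n)) 0                  ≈⟨ ℚᵘ.*≡* (cong (ℤ._* ℤ.+ 1)
      (cong₂ ℤ._+_ (sym (ℤ.*-identityʳ (ℤ.+ m))) (sym (ℤ.*-identityʳ (ℤ.+ n))))) ⟩
    ℚᵘ.mkℚᵘ (ℤ.+ m) 0 ℚᵘ.+ ℚᵘ.mkℚᵘ (ℤ.+ n) 0     ≈⟨ ℚᵘ.≃-sym (ℚᵘ.+-cong (ιᵘ m) (ιᵘ n)) ⟩
    ℚ.toℚᵘ (ι m) ℚᵘ.+ ℚ.toℚᵘ (ι n)           ≈⟨ ℚᵘ.≃-sym (ℚ.toℚᵘ-homo-+ (ι m) (ι n)) ⟩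
    ℚ.toℚᵘ (ι m + ι n)                       ∎)
    where open ℚᵘ.≃-Reasoning

  ι-* : ∀ m n → ι (m ℕ.* n) ≡ ι m * ι n
  ι-* m n = ℚ.toℚᵘ-injective (begin
    ℚ.toℚᵘ (ι (m ℕ.* n))                     ≈⟨ ιᵘ (m ℕ.* n) ⟩
    ℚᵘ.mkℚᵘ (ℤ.+ (m ℕ.* n)) 0                  ≈⟨ ℚᵘ.*≡* (cong (ℤ._* ℤ.+ 1) (ℤ.pos-* m n)) ⟩
    ℚᵘ.mkℚᵘ (ℤ.+ m) 0 ℚᵘ.* ℚᵘ.mkℚᵘ (ℤ.+ n) 0     ≈⟨ ℚᵘ.≃-sym (ℚᵘ.*-cong (ιᵘ m) (ιᵘ n)) ⟩
    ℚ.toℚᵘ (ι m) ℚᵘ.* ℚ.toℚᵘ (ι n)           ≈⟨ ℚᵘ.≃-sym (ℚ.toℚᵘ-homo-* (ι m) (ι n)) ⟩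
    ℚ.toℚᵘ (ι m * ι n)                       ∎)
    where open ℚᵘ.≃-Reasoning

  0≤ι : ∀ n → 0ℚ ℚ.≤ ι n
  0≤ι n = ℚ.nonNegative⁻¹ _ {{ℚ.normalize-nonNeg n 1}}

  0<ι : ∀ {n} → 1 ≤ n → 0ℚ ℚ.< ι n
  0<ι {suc n} _ = ℚ.positive⁻¹ _ {{ℚ.normalize-pos (suc n) 1}}

  ι-mono : ∀ {m n} → m ≤ n → ι m ℚ.≤ ι n
  ι-mono {m} {n} m≤n = subst (λ k → ι m ℚ.≤ ι k) (ℕ.m+[n∸m]≡n m≤n)
    (subst (ι m ℚ.≤_) (sym (ι-+ m (n ℕ.∸ m))) (p≤p+q (ι m) (0≤ι (n ℕ.∸ m))))

  ι-0 : ι 0 ≡ 0ℚ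
  ι-0 = refl

  ι-1 : ι 1 ≡ 1ℚ
  ι-1 = refl

ι-suc : ∀ n → ι (suc n) ≡ 1ℚ + ι n
ι-suc n = trans (ι-+ 1 n) (cong (_+ ι n) ι-1)

-- Eventual inequality of sequences

infix 4 _≲_

-- _≤ᵣ_ on bare sequences, as a record so that f and g can be inferred.
record _≲_ (f g : ℕ → ℚ) : Set where
  constructor eventually
  field
    within : ∀ δ → 0ℚ ℚ.< δ → ∃[ N ] (∀ n → N ≤ n → f n ℚ.≤ g n + δ)

open _≲_

≤⇒≲ : ∀ {f g} → (∀ n → f n ℚ.≤ g n) → f ≲ g
≤⇒≲ f≤g .within δ 0<δ = 0 , λ n _ → ℚ.≤-trans (f≤g n) (p≤p+q _ (ℚ.<⇒≤ 0<δ))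

≡⇒≲ : ∀ {f g} → (∀ n → f n ≡ g n) → f ≲ g
≡⇒≲ f≡g = ≤⇒≲ (λ n → ℚ.≤-reflexive (f≡g n))

≲-refl : ∀ {f} → f ≲ f
≲-refl = ≡⇒≲ (λ _ → refl)

≲-trans : ∀ {f g h} → f ≲ g → g ≲ h → f ≲ h
≲-trans {f} {g} {h} f≲g g≲h .within δ 0<δ =
  let M , p = within f≲g (δ * ½) (half-pos 0<δ)
      N , q = within g≲h (δ * ½) (half-pos 0<δ)
  in M ℕ.⊔ N , λ n ≤n →
    subst (f n ℚ.≤_)
      (trans (ℚ.+-assoc (h n) (δ * ½) (δ * ½)) (cong (h n +_) (half+half δ)))
      (ℚ.≤-trans (p n (ℕ.m⊔n≤o⇒m≤o M N ≤n)) (ℚ.+-monoˡ-≤ (δ * ½) (q n (ℕ.m⊔n≤o⇒n≤o M N ≤n))))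

≲-+ : ∀ {f g f′ g′} → f ≲ g → f′ ≲ g′ → (λ n → f n + f′ n) ≲ (λ n → g n + g′ n)
≲-+ {f} {g} {f′} {g′} f≲g f′≲g′ .within δ 0<δ =
  let M , p = within f≲g (δ * ½) (half-pos 0<δ)
      N , q = within f′≲g′ (δ * ½) (half-pos 0<δ)
  in M ℕ.⊔ N , λ n ≤n →
    subst (f n + f′ n ℚ.≤_)
      (trans (S.solve 3 (λ a b d → (a S.:+ d) S.:+ (b S.:+ d) S.:= (a S.:+ b) S.:+ (d S.:+ d))
                 refl (g n) (g′ n) (δ * ½))
             (cong ((g n + g′ n) +_) (half+half δ)))
      (ℚ.+-mono-≤ (p n (ℕ.m⊔n≤o⇒m≤o M N ≤n)) (q n (ℕ.m⊔n≤o⇒n≤o M N ≤n)))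

≤ᵣ⇒≲ : ∀ x y → x ≤ᵣ y → seq x ≲ seq y
≤ᵣ⇒≲ x y = eventually

≲-* : ∀ {f g} c → 0ℚ ℚ.< c → f ≲ g → (λ n → c * f n) ≲ (λ n → c * g n)
≲-* {f} {g} c 0<c f≲g .within δ 0<δ =
  let N , p = within f≲g (δ * recip c) (*-pos 0<δ (recip-pos c 0<c))
  in N , λ n ≤n →
    subst (c * f n ℚ.≤_)
      (trans (ℚ.*-distribˡ-+ c (g n) (δ * recip c)) (cong (c * g n +_) (scaled δ 0<c)))
      (*-monoˡ c (ℚ.<⇒≤ 0<c) (p n ≤n))

-- Sums over lists of buffers

-- Sets of buffers are lists because they are repeatedly split into a block and a rest, which `_++_`
-- and `_↭_` express directly.
∑ : ∀ {m} → List (Fin m) → (Fin m → ℝ) → ℝ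
∑ []      f = 0ᵣ
∑ (i ∷ S) f = f i +ᵣ ∑ S f

module _ {m : ℕ} where

  ∑-++ : ∀ (S E : List (Fin m)) f n → seq (∑ (S ++ E) f) n ≡ seq (∑ S f) n + seq (∑ E f) n
  ∑-++ []      E f n = sym (ℚ.+-identityˡ _)
  ∑-++ (i ∷ S) E f n = trans (cong (seq (f i) n +_) (∑-++ S E f n))
    (sym (ℚ.+-assoc (seq (f i) n) (seq (∑ S f) n) (seq (∑ E f) n)))

  ∑-↭ : ∀ {S S′ : List (Fin m)} → S ↭ S′ → ∀ f n → seq (∑ S f) n ≡ seq (∑ S′ f) n
  ∑-↭ ↭.refl       f n = refl
  ∑-↭ (↭.prep i p)   f n = cong (seq (f i) n +_) (∑-↭ p f n)
  ∑-↭ {i ∷ j ∷ S} {_ ∷ _ ∷ S′} (↭.swap _ _ p) f n = trans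
    (cong (λ x → seq (f i) n + (seq (f j) n + x)) (∑-↭ p f n))
    (S.solve 3 (λ a b c → a S.:+ (b S.:+ c) S.:= b S.:+ (a S.:+ c)) refl
      (seq (f i) n) (seq (f j) n) (seq (∑ S′ f) n))
  ∑-↭ (↭.trans p q)  f n = trans (∑-↭ p f n) (∑-↭ q f n)

  ∑-+ : ∀ (S : List (Fin m)) f g n →
        seq (∑ S (λ i → f i +ᵣ g i)) n ≡ seq (∑ S f) n + seq (∑ S g) n
  ∑-+ []      f g n = sym (ℚ.+-identityˡ 0ℚ)
  ∑-+ (i ∷ S) f g n = trans (cong (seq (f i +ᵣ g i) n +_) (∑-+ S f g n))
    (S.solve 4 (λ a b c d → (a S.:+ b) S.:+ (c S.:+ d) S.:= (a S.:+ c) S.:+ (b S.:+ d)) refl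
      (seq (f i) n) (seq (g i) n) (seq (∑ S f) n) (seq (∑ S g) n))

  ∑-0 : ∀ (S : List (Fin m)) n → seq (∑ S (λ _ → 0ᵣ)) n ≡ 0ℚ
  ∑-0 []      n = refl
  ∑-0 (i ∷ S) n = trans (ℚ.+-identityˡ _) (∑-0 S n)

  ∑-mono-≲ : ∀ (S : List (Fin m)) f g → (∀ i → seq (f i) ≲ seq (g i)) → seq (∑ S f) ≲ seq (∑ S g)
  ∑-mono-≲ []      f g f≲g = ≡⇒≲ (λ _ → refl)
  ∑-mono-≲ (i ∷ S) f g f≲g =
    ≲-+ (f≲g i) (∑-mono-≲ S f g f≲g)

  ∑-mono-≤ : ∀ (S : List (Fin m)) f g n → (∀ {i} → i ∈ S → seq (f i) n ℚ.≤ seq (g i) n) →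
             seq (∑ S f) n ℚ.≤ seq (∑ S g) n
  ∑-mono-≤ []      f g n h = ℚ.≤-refl
  ∑-mono-≤ (i ∷ S) f g n h = ℚ.+-mono-≤ (h (here refl)) (∑-mono-≤ S f g n (λ i∈S → h (there i∈S)))

-- Approximate choice of the heaviest block

-- The order of two reals is not decidable, but with a slack `τ` it suffices to compare the rational
-- terms at an index `N` after which the difference varies by less than `τ`.
≲-compare : ∀ x y τ → 0ℚ ℚ.< τ → seq x ≲ (λ n → seq y n + τ) ⊎ seq y ≲ (λ n → seq x n + τ)
≲-compare x y τ 0<τ with cauchy (x -ᵣ y) τ 0<τ
... | N , h with ℚ.≤-total (seq x N) (seq y N)
... | inj₁ x≤y = inj₁ (eventually λ δ 0<δ → N , λ n N≤n → ℚ.≤-trans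
        (bound (seq x n) (seq y n) (seq x N) (seq y N) x≤y (dist⇒< (h n N N≤n ℕ.≤-refl)))
        (p≤p+q _ (ℚ.<⇒≤ 0<δ)))
  where
  bound : ∀ a b c d → c ℚ.≤ d → a - b ℚ.< (c - d) + τ → a ℚ.≤ b + τ
  bound a b c d c≤d lt = subst₂ ℚ._≤_
    (S.solve 4 (λ a b c d → (a S.:- b) S.:+ (b S.:+ c) S.:- c S.:= a) refl a b c d)
    (S.solve 4 (λ b c d t → ((c S.:- d) S.:+ t) S.:+ (b S.:+ d) S.:- c S.:= b S.:+ t) refl b c d τ)
    (ℚ.+-monoˡ-≤ (ℚ.- c) (ℚ.+-mono-≤ (ℚ.<⇒≤ lt) (ℚ.+-monoʳ-≤ b c≤d)))
... | inj₂ y≤x = inj₂ (eventually λ δ 0<δ → N , λ n N≤n → ℚ.≤-trans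
        (bound (seq x n) (seq y n) (seq x N) (seq y N) y≤x (dist⇒< (h N n ℕ.≤-refl N≤n)))
        (p≤p+q _ (ℚ.<⇒≤ 0<δ)))
  where
  bound : ∀ a b c d → d ℚ.≤ c → c - d ℚ.< (a - b) + τ → b ℚ.≤ a + τ
  bound a b c d d≤c lt = subst₂ ℚ._≤_
    (S.solve 3 (λ b c d → (c S.:- d) S.:+ (b S.:+ d) S.:- c S.:= b) refl b c d)
    (S.solve 4 (λ a b c t → ((a S.:- b) S.:+ t) S.:+ (b S.:+ c) S.:- c S.:= a S.:+ t) refl a b c τ)
    (ℚ.+-monoˡ-≤ (ℚ.- c) (ℚ.+-mono-≤ (ℚ.<⇒≤ lt) (ℚ.+-monoʳ-≤ b d≤c)))

-- Pigeonhole by a running maximum: the first `d` buffers are compared with the heaviest block of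
-- the remaining ones, and the winner is kept. Half of `τ` goes to the recursive call, half to the
-- comparison.
heaviest-block : ∀ {m} (f : Fin m → ℝ) c d S → length S ≡ suc c ℕ.* d → ∀ τ → 0ℚ ℚ.< τ →
  ∃[ D ] ∃[ E ] (S ↭ D ++ E × length D ≡ d ×
                 seq (∑ S f) ≲ (λ n → ι (suc c) * seq (∑ D f) n + τ))
heaviest-block f zero    d S |S| τ 0<τ =
  S , [] , ↭-reflexive (sym (List.++-identityʳ S)) , trans |S| (ℕ.*-identityˡ d)
  , ≤⇒≲ (λ n → subst (ℚ._≤ ι 1 * seq (∑ S f) n + τ) (trans (cong (_* seq (∑ S f) n) ι-1) (ℚ.*-identityˡ _)) (p≤p+q _ (ℚ.<⇒≤ 0<τ)))
heaviest-block {m} f (suc c) d S |S| τ 0<τ = choose (≲-compare (∑ S₁ f) (∑ D f) ρ 0<ρ)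
  where
  S₁ R : List (Fin m)
  S₁ = take d S
  R  = drop d S
  |R| : length R ≡ suc c ℕ.* d
  |R| = trans (List.length-drop d S) (trans (cong (ℕ._∸ d) |S|) (ℕ.m+n∸m≡n d (suc c ℕ.* d)))
  |S₁| : length S₁ ≡ d
  |S₁| = trans (List.length-take d S)
    (ℕ.m≤n⇒m⊓n≡m (subst (d ℕ.≤_) (sym |S|) (ℕ.m≤m+n d (suc c ℕ.* d))))
  -- The error is multiplied by suc c when the block D is replaced by S₁.
  C ρ : ℚ
  C = ι (suc (suc c))
  ρ = (τ * ½) * recip C
  0<C : 0ℚ ℚ.< C
  0<C = 0<ι {suc (suc c)} (s≤s z≤n)
  0<ρ : 0ℚ ℚ.< ρ
  0<ρ = *-pos (half-pos 0<τ) (recip-pos C 0<C)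
  IH = heaviest-block f c d R |R| (τ * ½) (half-pos 0<τ)
  D = IH .proj₁
  E = IH .proj₂ .proj₁
  R↭DE = IH .proj₂ .proj₂ .proj₁
  |D| = IH .proj₂ .proj₂ .proj₂ .proj₁
  R≲D = IH .proj₂ .proj₂ .proj₂ .proj₂
  ∑S : ∀ n → seq (∑ S f) n ≡ seq (∑ S₁ f) n + seq (∑ R f) n
  ∑S n = trans (cong (λ S → seq (∑ S f) n) (sym (List.take++drop≡id d S))) (∑-++ S₁ R f n)
  ρ≤½τ : ρ ℚ.≤ τ * ½
  ρ≤½τ = subst₂ ℚ._≤_ (trans (cong (_* ρ) ι-1) (ℚ.*-identityˡ ρ)) (scaled (τ * ½) 0<C)
    (*-monoʳ ρ (ℚ.<⇒≤ 0<ρ) (ι-mono {1} {suc (suc c)} (s≤s z≤n)))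
  choose : _ → _
  choose (inj₁ S₁≲D) =
    D , S₁ ++ E
    , ↭-trans (↭-reflexive (sym (List.take++drop≡id d S)))
        (↭-trans (↭.++⁺ˡ S₁ R↭DE) (↭.shifts S₁ D))
    , |D|
    , ≲-trans (≡⇒≲ ∑S)
        (≲-trans (≲-+ S₁≲D R≲D)
          (≤⇒≲ λ n → subst₂ ℚ._≤_
            (S.solve 4 (λ d c h r → d S.:+ (c S.:* d) S.:+ h S.:+ r S.:= (d S.:+ r) S.:+ (c S.:* d S.:+ h))
              refl (seq (∑ D f) n) (ι (suc c)) (τ * ½) ρ)
            (trans
              (S.solve 3 (λ d c h → d S.:+ (c S.:* d) S.:+ h S.:+ h S.:=
                                    (S.con 1ℚ S.:+ c) S.:* d S.:+ (h S.:+ h))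
                refl (seq (∑ D f) n) (ι (suc c)) (τ * ½))
              (cong₂ (λ C′ t → C′ * seq (∑ D f) n + t) (sym (ι-suc (suc c))) (half+half τ)))
            (ℚ.+-monoʳ-≤ (seq (∑ D f) n + ι (suc c) * seq (∑ D f) n + τ * ½) ρ≤½τ)))
  choose (inj₂ D≲S₁) =
    S₁ , R , ↭-reflexive (sym (List.take++drop≡id d S)) , |S₁|
    , ≲-trans (≡⇒≲ ∑S)
        (≲-trans (≲-+ (≲-refl {seq (∑ S₁ f)}) R≲D)
          (≲-trans (≲-+ (≲-refl {seq (∑ S₁ f)})
                     (≲-+ (≲-* (ι (suc c)) (0<ι {suc c} (s≤s z≤n)) D≲S₁) (≲-refl {λ _ → τ * ½})))
            (≤⇒≲ λ n → subst₂ ℚ._≤_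
              (S.solve 4 (λ s c h r → (S.con 1ℚ S.:+ c) S.:* s S.:+ h S.:+ c S.:* r S.:=
                                      s S.:+ (c S.:* (s S.:+ r) S.:+ h))
                refl (seq (∑ S₁ f) n) (ι (suc c)) (τ * ½) ρ)
              (trans
                (S.solve 4 (λ s c h r → (S.con 1ℚ S.:+ c) S.:* s S.:+ h S.:+ (S.con 1ℚ S.:+ c) S.:* r S.:=
                                        (S.con 1ℚ S.:+ c) S.:* s S.:+ (h S.:+ (S.con 1ℚ S.:+ c) S.:* r))
                  refl (seq (∑ S₁ f) n) (ι (suc c)) (τ * ½) ρ)
                (trans (cong (λ C′ → C′ * seq (∑ S₁ f) n + (τ * ½ + C′ * ρ)) (sym (ι-suc (suc c))))
                  (cong (C * seq (∑ S₁ f) n +_)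
                    (trans (cong (τ * ½ +_) (scaled (τ * ½) 0<C)) (half+half τ)))))
              (ℚ.+-monoʳ-≤ ((1ℚ + ι (suc c)) * seq (∑ S₁ f) n + τ * ½) (*-monoʳ ρ (ℚ.<⇒≤ 0<ρ)
                (subst (ι (suc c) ℚ.≤_) (ι-suc (suc c)) (ι-mono (ℕ.n≤1+n (suc c)))))))))

-- Estimates for (1 + 1/K)^K, e and e / (e - 1)

abstract
  ι-unit-fraction : ∀ m .{{_ : ℕ.NonZero m}} → ι m * (ℤ.+ 1 ℚ./ m) ≡ 1ℚ
  ι-unit-fraction m@(suc m-1) = ℚ.toℚᵘ-injective (begin
    ℚ.toℚᵘ (ι m * (ℤ.+ 1 ℚ./ m))                       ≈⟨ ℚ.toℚᵘ-homo-* (ι m) (ℤ.+ 1 ℚ./ m) ⟩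
    ℚ.toℚᵘ (ι m) ℚᵘ.* ℚ.toℚᵘ (ℤ.+ 1 ℚ./ m)             ≈⟨ ℚᵘ.*-cong (ιᵘ m) (ℚ.toℚᵘ-fromℚᵘ (ℚᵘ.mkℚᵘ (ℤ.+ 1) m-1)) ⟩
    ℚᵘ.mkℚᵘ (ℤ.+ m) 0 ℚᵘ.* ℚᵘ.mkℚᵘ (ℤ.+ 1) m-1         ≈⟨ ℚᵘ.*≡* (cong ℤ.+_ eq) ⟩
    ℚᵘ.1ℚᵘ                                             ∎)
    where
    open ℚᵘ.≃-Reasoning
    eq : m ℕ.* 1 ℕ.* 1 ≡ 1 ℕ.* (1 ℕ.* m)
    eq = trans (ℕ.*-identityʳ (m ℕ.* 1)) (trans (ℕ.*-identityʳ m)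
      (sym (trans (ℕ.*-identityˡ (1 ℕ.* m)) (ℕ.*-identityˡ m))))

invFact-suc : ∀ n → invFact n ≡ ι (suc n) * invFact (suc n)
invFact-suc n = begin
  f                            ≡⟨ sym (ℚ.*-identityʳ f) ⟩
  f * 1ℚ                       ≡⟨ cong (f *_) (sym (ι-unit-fraction (suc n !) {{suc n ℕ.!≢0}})) ⟩
  f * (ι (suc n !) * f′)       ≡⟨ cong (λ x → f * (x * f′)) (ι-* (suc n) (n !)) ⟩
  f * ((ι (suc n) * ι (n !)) * f′)
    ≡⟨ S.solve 4 (λ f f′ a b → f S.:* ((a S.:* b) S.:* f′) S.:= (b S.:* f) S.:* (a S.:* f′)) refl f f′ (ι (suc n)) (ι (n !)) ⟩
  (ι (n !) * f) * (ι (suc n) * f′) ≡⟨ cong (_* (ι (suc n) * f′)) (ι-unit-fraction (n !) {{n ℕ.!≢0}}) ⟩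
  1ℚ * (ι (suc n) * f′)        ≡⟨ ℚ.*-identityˡ _ ⟩
  ι (suc n) * f′               ∎
  where
  open ≡-Reasoning
  f = invFact n
  f′ = invFact (suc n)

infixr 8 _↑_

_↑_ : ℚ → ℕ → ℚ
z ↑ zero  = 1ℚ
z ↑ suc n = z * z ↑ n

1↑ : ∀ n → 1ℚ ↑ n ≡ 1ℚ
1↑ zero    = refl
1↑ (suc n) = trans (ℚ.*-identityˡ _) (1↑ n)

0≤* : ∀ {p q} → 0ℚ ℚ.≤ p → 0ℚ ℚ.≤ q → 0ℚ ℚ.≤ p * q
0≤* {p} {q} 0≤p 0≤q = subst (ℚ._≤ p * q) (ℚ.*-zeroʳ p) (*-monoˡ p 0≤p 0≤q)

0≤↑ : ∀ {z} n → 0ℚ ℚ.≤ z → 0ℚ ℚ.≤ z ↑ n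
0≤↑ zero    0≤z = ℚ.<⇒≤ (ℚ.positive⁻¹ 1ℚ)
0≤↑ (suc n) 0≤z = 0≤* 0≤z (0≤↑ n 0≤z)

-- The first two terms of the binomial expansion; the induction step drops a nonnegative term with
-- `y * y`. The homogeneous form can be summed over `n` with factorial weights in `expSumAt-+`.
bernoulli : ∀ {z y} n → 0ℚ ℚ.≤ z → 0ℚ ℚ.≤ y →
            z ↑ suc n + ι (suc n) * (y * z ↑ n) ℚ.≤ (z + y) ↑ suc n
bernoulli {z} {y} zero    0≤z 0≤y = ℚ.≤-reflexive
  (trans (cong (λ i → z * 1ℚ + i * (y * 1ℚ)) ι-1)
    (S.solve 2 (λ z y → z S.:* S.con 1ℚ S.:+ S.con 1ℚ S.:* (y S.:* S.con 1ℚ) S.:= (z S.:+ y) S.:* S.con 1ℚ) refl z y))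
bernoulli {z} {y} (suc n) 0≤z 0≤y = begin
  z * z ↑ suc n + ι (suc (suc n)) * (y * z ↑ suc n)
    ≤⟨ p≤p+q _ (0≤* (0≤ι (suc n)) (0≤* (0≤* 0≤y 0≤y) (0≤↑ n 0≤z))) ⟩
  z * z ↑ suc n + ι (suc (suc n)) * (y * z ↑ suc n) + ι (suc n) * ((y * y) * z ↑ n)
    ≡⟨ cong (λ i → z * z ↑ suc n + i * (y * z ↑ suc n) + ι (suc n) * ((y * y) * z ↑ n)) (ι-suc (suc n)) ⟩
  z * z ↑ suc n + (1ℚ + ι (suc n)) * (y * z ↑ suc n) + ι (suc n) * ((y * y) * z ↑ n)
    ≡⟨ S.solve 4 (λ z y i w → z S.:* (z S.:* w) S.:+ (S.con 1ℚ S.:+ i) S.:* (y S.:* (z S.:* w)) S.:+ i S.:* ((y S.:* y) S.:* w)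
         S.:= (z S.:+ y) S.:* (z S.:* w S.:+ i S.:* (y S.:* w))) refl z y (ι (suc n)) (z ↑ n) ⟩
  (z + y) * (z ↑ suc n + ι (suc n) * (y * z ↑ n))
    ≤⟨ *-monoˡ (z + y) (ℚ.+-mono-≤ 0≤z 0≤y) (bernoulli n 0≤z 0≤y) ⟩
  (z + y) * (z + y) ↑ suc n ∎
  where open ℚ.≤-Reasoning

expSumAt : ℚ → ℕ → ℚ
expSumAt z zero    = 0ℚ
expSumAt z (suc n) = expSumAt z n + z ↑ n * invFact n

expSumAt-1 : ∀ n → expSumAt 1ℚ n ≡ expSum n
expSumAt-1 zero    = refl
expSumAt-1 (suc n) = cong₂ _+_ (expSumAt-1 n) (trans (cong (_* invFact n) (1↑ n)) (ℚ.*-identityˡ _))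

-- The partial-sum form of exp (z + y) ≥ (1 + y) exp z.
expSumAt-+ : ∀ {z y} n → 0ℚ ℚ.≤ z → 0ℚ ℚ.≤ y →
             expSumAt z (suc n) + y * expSumAt z n ℚ.≤ expSumAt (z + y) (suc n)
expSumAt-+ {z} {y} zero    0≤z 0≤y = ℚ.≤-reflexive
  (S.solve 2 (λ y f → (S.con 0ℚ S.:+ S.con 1ℚ S.:* f) S.:+ y S.:* S.con 0ℚ S.:= S.con 0ℚ S.:+ S.con 1ℚ S.:* f) refl y (invFact 0))
expSumAt-+ {z} {y} (suc n) 0≤z 0≤y = begin
  (expSumAt z (suc n) + z ↑ suc n * f′) + y * (expSumAt z n + z ↑ n * invFact n)
    ≡⟨ cong (λ x → (expSumAt z (suc n) + z ↑ suc n * f′) + y * (expSumAt z n + z ↑ n * x)) (invFact-suc n) ⟩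
  (expSumAt z (suc n) + z ↑ suc n * f′) + y * (expSumAt z n + z ↑ n * (ι (suc n) * f′))
    ≡⟨ S.solve 7 (λ a b y f z w i → (a S.:+ z S.:* f) S.:+ y S.:* (b S.:+ w S.:* (i S.:* f)) S.:=
         (a S.:+ y S.:* b) S.:+ (z S.:+ i S.:* (y S.:* w)) S.:* f) refl
         (expSumAt z (suc n)) (expSumAt z n) y f′ (z ↑ suc n) (z ↑ n) (ι (suc n)) ⟩
  (expSumAt z (suc n) + y * expSumAt z n) + (z ↑ suc n + ι (suc n) * (y * z ↑ n)) * f′
    ≤⟨ ℚ.+-mono-≤ (expSumAt-+ n 0≤z 0≤y) (*-monoʳ f′ (ℚ.<⇒≤ (invFact-pos (suc n))) (bernoulli n 0≤z 0≤y)) ⟩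
  expSumAt (z + y) (suc n) + (z + y) ↑ suc n * f′ ∎
  where
  open ℚ.≤-Reasoning
  f′ = invFact (suc n)

expSumAt-mono : ∀ {z} n → 0ℚ ℚ.≤ z → expSumAt z n ℚ.≤ expSumAt z (suc n)
expSumAt-mono n 0≤z = p≤p+q _ (0≤* (0≤↑ n 0≤z) (ℚ.<⇒≤ (invFact-pos n)))

-- Each factor 1 + y is absorbed by moving the argument of exp by `y`, at the price of one more term
-- in the partial sum.
compound≤exp : ∀ {y} → 0ℚ ℚ.≤ y → ∀ j → (1ℚ + y) ↑ j ℚ.≤ expSumAt (ι j * y) (suc j)
compound≤exp {y} 0≤y zero = ℚ.≤-reflexive refl
compound≤exp {y} 0≤y (suc j) = begin
  (1ℚ + y) * (1ℚ + y) ↑ j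
    ≤⟨ *-monoˡ (1ℚ + y) (ℚ.+-mono-≤ (ℚ.<⇒≤ (ℚ.positive⁻¹ 1ℚ)) 0≤y) (compound≤exp 0≤y j) ⟩
  (1ℚ + y) * expSumAt z (suc j)
    ≡⟨ S.solve 2 (λ y x → (S.con 1ℚ S.:+ y) S.:* x S.:= x S.:+ y S.:* x) refl y (expSumAt z (suc j)) ⟩
  expSumAt z (suc j) + y * expSumAt z (suc j)            ≤⟨ ℚ.+-monoˡ-≤ _ (expSumAt-mono (suc j) 0≤z) ⟩
  expSumAt z (suc (suc j)) + y * expSumAt z (suc j)      ≤⟨ expSumAt-+ (suc j) 0≤z 0≤y ⟩
  expSumAt (z + y) (suc (suc j))
    ≡⟨ cong (λ x → expSumAt x (suc (suc j))) (sym (trans (cong (_* y) (ι-suc j))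
                                                              (S.solve 2 (λ j y → (S.con 1ℚ S.:+ j) S.:* y S.:= j S.:* y S.:+ y) refl (ι j) y))) ⟩
  expSumAt (ι (suc j) * y) (suc (suc j))                 ∎
  where
  open ℚ.≤-Reasoning
  z = ι j * y
  0≤z : 0ℚ ℚ.≤ z
  0≤z = 0≤* (0≤ι j) 0≤y

compound≤e : ∀ {y} K → 0ℚ ℚ.≤ y → ι K * y ≡ 1ℚ → ∀ {n} → suc K ≤ n → (1ℚ + y) ↑ K ℚ.≤ expSum n
compound≤e {y} K 0≤y Ky≡1 {n} K<n = begin
  (1ℚ + y) ↑ K                  ≤⟨ compound≤exp 0≤y K ⟩
  expSumAt (ι K * y) (suc K)    ≡⟨ cong (λ z → expSumAt z (suc K)) Ky≡1 ⟩
  expSumAt 1ℚ (suc K)           ≡⟨ expSumAt-1 (suc K) ⟩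
  expSum (suc K)                ≤⟨ expSum-lower K<n ⟩
  expSum n                      ∎
  where open ℚ.≤-Reasoning

-- Bernoulli's inequality at 1, where `y` is the reciprocal of `suc K`.
2≤compound : ∀ {y} K → 0ℚ ℚ.≤ y → ι (suc K) * y ≡ 1ℚ → 1ℚ + 1ℚ ℚ.≤ (1ℚ + y) ↑ suc K
2≤compound {y} K 0≤y Ky≡1 = subst (ℚ._≤ (1ℚ + y) ↑ suc K)
  (cong₂ _+_ (1↑ (suc K)) (trans (cong (ι (suc K) *_) (trans (cong (y *_) (1↑ K)) (ℚ.*-identityʳ y))) Ky≡1))
  (bernoulli K (ℚ.<⇒≤ (ℚ.positive⁻¹ 1ℚ)) 0≤y)

-- As `y` is 1/K, each factor 1 + K splits into (1 + y) K.
ι-↑ : ∀ {y} K → ι K * y ≡ 1ℚ → ∀ j → ι (suc K ℕ.^ j) ≡ (1ℚ + y) ↑ j * ι (K ℕ.^ j)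
ι-↑ K Ky≡1 zero = trans ι-1 (sym (trans (ℚ.*-identityˡ _) ι-1))
ι-↑ {y} K Ky≡1 (suc j) = begin
  ι (suc K ℕ.* suc K ℕ.^ j)                            ≡⟨ ι-* (suc K) (suc K ℕ.^ j) ⟩
  ι (suc K) * ι (suc K ℕ.^ j)
    ≡⟨ cong₂ _*_ (trans (ι-suc K) (cong (_+ ι K) (sym Ky≡1))) (ι-↑ K Ky≡1 j) ⟩
  (ι K * y + ι K) * ((1ℚ + y) ↑ j * ι (K ℕ.^ j))
    ≡⟨ S.solve 4 (λ k y x z → (k S.:* y S.:+ k) S.:* (x S.:* z) S.:= ((S.con 1ℚ S.:+ y) S.:* x) S.:* (k S.:* z))
                                                            refl (ι K) y ((1ℚ + y) ↑ j) (ι (K ℕ.^ j)) ⟩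
  ((1ℚ + y) * (1ℚ + y) ↑ j) * (ι K * ι (K ℕ.^ j))      ≡⟨ cong ((1ℚ + y) ↑ suc j *_) (sym (ι-* K (K ℕ.^ j))) ⟩
  (1ℚ + y) ↑ suc j * ι (K ℕ.* K ℕ.^ j)                 ∎
  where open ≡-Reasoning

-- As x / (x - 1) decreases in x, the lower bound on E / (E - 1 + 2y) needs no
-- more about E than that it is at most a, which stands for e.
ratio : ∀ {a E y ε z} → 1ℚ + 1ℚ ℚ.≤ a → 1ℚ + 1ℚ ℚ.≤ E → E ℚ.≤ a → 0ℚ ℚ.≤ y → 0ℚ ℚ.≤ ε →
        z ℚ.≤ a * recip (a - 1ℚ) - ε →
        z * (E - 1ℚ + (y + y)) + (ε - ((y + y) + (y + y))) ℚ.≤ E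
ratio {a} {E} {y} {ε} {z} 2≤a 2≤E E≤a 0≤y 0≤ε z≤ = begin
  z * w + (ε - (y₂ + y₂))                                ≤⟨ ℚ.+-monoˡ-≤ _ (*-monoʳ w 0≤w z≤) ⟩
  (a * r - ε) * w + (ε - (y₂ + y₂))                      ≡⟨ S.solve 5 (λ a r e E y →
      (a S.:* r S.:- e) S.:* (E S.:- S.con 1ℚ S.:+ y) S.:+ (e S.:- (y S.:+ y)) S.:=
      ((a S.:- S.con 1ℚ) S.:* r S.:+ r) S.:* (E S.:- S.con 1ℚ S.:+ y) S.:+ (S.:- (y S.:+ y) S.:- e S.:* (E S.:- S.con 1ℚ S.:- S.con 1ℚ S.:+ y)))
      refl a r ε E y₂ ⟩
  ((a - 1ℚ) * r + r) * w + (ℚ.- (y₂ + y₂) - ε * w′)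
    -- `r` is the reciprocal of `a - 1`, so `a * r`, rewritten as `(a - 1) * r + r`, becomes
    -- `1ℚ + r`.
    ≡⟨ cong (λ x → (x + r) * w + (ℚ.- (y₂ + y₂) - ε * w′)) (recip-inverse (a - 1ℚ) 0<a-1) ⟩
  (1ℚ + r) * w + (ℚ.- (y₂ + y₂) - ε * w′)                ≡⟨ S.solve 5 (λ a r e E y →
      (S.con 1ℚ S.:+ r) S.:* (E S.:- S.con 1ℚ S.:+ y) S.:+ (S.:- (y S.:+ y) S.:- e S.:* (E S.:- S.con 1ℚ S.:- S.con 1ℚ S.:+ y)) S.:=
      (E S.:- S.con 1ℚ S.:- y S.:- e S.:* (E S.:- S.con 1ℚ S.:- S.con 1ℚ S.:+ y)) S.:+ r S.:* (E S.:- S.con 1ℚ) S.:+ r S.:* y)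
      refl a r ε E y₂ ⟩
  (E - 1ℚ - y₂ - ε * w′) + r * (E - 1ℚ) + r * y₂
    -- `r * (E - 1ℚ)` is at most 1 because `E` is at most `a`, and `r` is at most 1 because `a` is
    -- at least 2.
    ≤⟨ ℚ.+-mono-≤ (ℚ.+-monoʳ-≤ (E - 1ℚ - y₂ - ε * w′) r[E-1]≤1) ry≤y ⟩
  (E - 1ℚ - y₂ - ε * w′) + 1ℚ + y₂
    ≡⟨ S.solve 3 (λ E y x → (E S.:- S.con 1ℚ S.:- y S.:- x) S.:+ S.con 1ℚ S.:+ y S.:= E S.:- x) refl E y₂ (ε * w′) ⟩
  -- `w′` is `w - 1ℚ`, nonnegative because `E` is at least 2. So lowering the factor by `ε` lowers
  -- the product with `w` by at least `ε`, which pays for the `ε` on the left.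
  E - ε * w′                                             ≤⟨ ℚ.+-monoʳ-≤ E (ℚ.neg-antimono-≤ (0≤* 0≤ε 0≤w′)) ⟩
  E + 0ℚ                                                 ≡⟨ ℚ.+-identityʳ E ⟩
  E                                                      ∎
  where
  open ℚ.≤-Reasoning
  y₂ = y + y
  r = recip (a - 1ℚ)
  w = E - 1ℚ + y₂
  w′ = E - 1ℚ - 1ℚ + y₂
  0≤y₂ : 0ℚ ℚ.≤ y₂
  0≤y₂ = ℚ.+-mono-≤ 0≤y 0≤y
  1≤x-1 : ∀ {x} → 1ℚ + 1ℚ ℚ.≤ x → 1ℚ ℚ.≤ x - 1ℚ
  1≤x-1 2≤x = ℚ.+-monoˡ-≤ (ℚ.- 1ℚ) 2≤x
  0<a-1 : 0ℚ ℚ.< a - 1ℚ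
  0<a-1 = ℚ.<-≤-trans (ℚ.positive⁻¹ 1ℚ) (1≤x-1 2≤a)
  0≤r : 0ℚ ℚ.≤ r
  0≤r = ℚ.<⇒≤ (recip-pos (a - 1ℚ) 0<a-1)
  0≤w : 0ℚ ℚ.≤ w
  0≤w = ℚ.+-mono-≤ (ℚ.≤-trans (ℚ.<⇒≤ (ℚ.positive⁻¹ 1ℚ)) (1≤x-1 2≤E)) 0≤y₂
  0≤w′ : 0ℚ ℚ.≤ w′
  0≤w′ = ℚ.+-mono-≤ (ℚ.+-monoˡ-≤ (ℚ.- 1ℚ) (1≤x-1 2≤E)) 0≤y₂
  r*[a-1] : r * (a - 1ℚ) ≡ 1ℚ
  r*[a-1] = trans (ℚ.*-comm r (a - 1ℚ)) (recip-inverse (a - 1ℚ) 0<a-1)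
  r[E-1]≤1 : r * (E - 1ℚ) ℚ.≤ 1ℚ
  r[E-1]≤1 = subst (r * (E - 1ℚ) ℚ.≤_) r*[a-1] (*-monoˡ r 0≤r (ℚ.+-monoˡ-≤ (ℚ.- 1ℚ) E≤a))
  r≤1 : r ℚ.≤ 1ℚ
  r≤1 = subst₂ ℚ._≤_ (ℚ.*-identityʳ r) r*[a-1] (*-monoˡ r 0≤r (1≤x-1 2≤a))
  ry≤y : r * y₂ ℚ.≤ y₂
  ry≤y = subst (r * y₂ ℚ.≤_) (ℚ.*-identityˡ y₂) (*-monoʳ y₂ 0≤y₂ r≤1)

-- Scripts and elementary facts about queues

none : ∀ {m} → Injection m
none = replicateᵛ _ 0

-- Injections with the buffers served in the step after them, most recent first.
Script : ℕ → Set
Script m = List (Injection m × Maybe (Fin m))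

history : ∀ {A : Set} → (ℕ → A) → ℕ → List A
history f zero    = []
history f (suc t) = f t ∷ history f t

total : ∀ {m} → List (Injection m) → ℕ
total []      = 0
total (p ∷ h) = total h ℕ.+ sum (lookup p)

module _ {m : ℕ} where

  serve-cong : ∀ s {q q′ : Fin m → ℕ} → q ≗ q′ → serve s q ≗ serve s q′
  serve-cong nothing  q≗q′ j = q≗q′ j
  serve-cong (just i) {q} {q′} q≗q′ j with i Fin.≟ j
  ... | yes refl = trans (updateAt-updates i q) (trans (cong ℕ.pred (q≗q′ i)) (sym (updateAt-updates i q′)))
  ... | no i≢j = trans (updateAt-minimal j i q (i≢j ∘ sym)) (trans (q≗q′ j) (sym (updateAt-minimal j i q′ (i≢j ∘ sym))))

  served-cong : ∀ s {q q′ : Fin m → ℕ} → q ≗ q′ → served s q ≡ served s q′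
  served-cong nothing  q≗q′ = refl
  served-cong (just i) q≗q′ = cong (1 ℕ.⊓_) (q≗q′ i)

sum-mono : ∀ {m} (f g : Fin m → ℕ) → (∀ i → f i ≤ g i) → sum f ≤ sum g
sum-mono {zero}  f g f≤g = z≤n
sum-mono {suc m} f g f≤g = ℕ.+-mono-≤ (f≤g zero) (sum-mono (f ∘ suc) (g ∘ suc) (f≤g ∘ suc))

sum-serve : ∀ {m} s (q : Fin m → ℕ) → served s q ℕ.+ sum (serve s q) ≡ sum q
sum-serve nothing        q = refl
sum-serve (just zero)    q = trans (sym (ℕ.+-assoc (1 ℕ.⊓ q zero) (ℕ.pred (q zero)) _))
                                   (cong (ℕ._+ sum (q ∘ suc)) (pred-1 (q zero)))
  where
  pred-1 : ∀ n → 1 ℕ.⊓ n ℕ.+ ℕ.pred n ≡ n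
  pred-1 zero    = refl
  pred-1 (suc n) = refl
sum-serve (just (suc i)) q = begin
  1 ℕ.⊓ q (suc i) ℕ.+ (q zero ℕ.+ sum (updateAt (q ∘ suc) i ℕ.pred))  ≡⟨ x∙yz≈y∙xz (1 ℕ.⊓ q (suc i)) (q zero) _ ⟩
  q zero ℕ.+ (1 ℕ.⊓ q (suc i) ℕ.+ sum (updateAt (q ∘ suc) i ℕ.pred))
    ≡⟨ cong (q zero ℕ.+_) (sum-serve (just i) (q ∘ suc)) ⟩
  q zero ℕ.+ sum (q ∘ suc)                                      ∎
  where open ≡-Reasoning

-- Conservation of packets in offline schedules

module Offline {m : ℕ} (B : ℕ) where

  mutual
    -- The recursion of `queue` and `left`, over a script instead of over time: the adversary builds
    -- its input step by step, before an input and a schedule exist as a whole.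
    queueAfter : Script m → Injection m → Fin m → ℕ
    queueAfter H p i = B ℕ.⊓ (leftAfter H i ℕ.+ lookup p i)

    leftAfter : Script m → Fin m → ℕ
    leftAfter []            i = 0
    leftAfter ((p , s) ∷ H) i = serve s (queueAfter H p) i

  sentAfter : Script m → ℕ
  sentAfter []            = 0
  sentAfter ((p , s) ∷ H) = sentAfter H ℕ.+ served s (queueAfter H p)

  Lossless : Script m → Set
  Lossless []            = ⊤
  Lossless ((p , s) ∷ H) = Lossless H × (∀ i → leftAfter H i ℕ.+ lookup p i ≤ B)

  module _ (s : Schedule m) (σ : Input m) where

    script : ℕ → Script m
    script = history (λ t → injection σ t , s t)

    mutual
      queue≡ : ∀ t i → queue B s σ t i ≡ queueAfter (script t) (injection σ t) i
      queue≡ t i = cong (λ l → B ℕ.⊓ (l ℕ.+ lookup (injection σ t) i)) (left≡ t i)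

      left≡ : ∀ t i → left B s σ t i ≡ leftAfter (script t) i
      left≡ zero    i = refl
      left≡ (suc t) i = serve-cong (s t) (queue≡ t) i

    sent≡ : ∀ n → sent B s σ n ≡ sentAfter (script n)
    sent≡ zero    = refl
    sent≡ (suc n) = cong₂ ℕ._+_ (sent≡ n) (served-cong (s n) (queue≡ n))

    past≡ : ∀ n → past σ n ≡ map proj₁ (script n)
    past≡ zero    = refl
    past≡ (suc n) = cong (injection σ n ∷_) (past≡ n)

  -- Every injected packet is sent, stored or cut off by the cap `B`. This bounds all schedules on
  -- an input.
  sent≤total : ∀ H → sentAfter H ℕ.+ sum (leftAfter H) ≤ total (map proj₁ H)
  sent≤total [] = ℕ.≤-reflexive (sum-replicate-zero m)
  sent≤total ((p , s) ∷ H) = begin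
    (sentAfter H ℕ.+ served s q) ℕ.+ sum (serve s q)           ≡⟨ ℕ.+-assoc (sentAfter H) _ _ ⟩
    sentAfter H ℕ.+ (served s q ℕ.+ sum (serve s q))           ≡⟨ cong (sentAfter H ℕ.+_) (sum-serve s q) ⟩
    sentAfter H ℕ.+ sum q
      ≤⟨ ℕ.+-monoʳ-≤ (sentAfter H) (sum-mono q _ (λ i → ℕ.m⊓n≤n B _)) ⟩
    sentAfter H ℕ.+ sum (λ i → leftAfter H i ℕ.+ lookup p i)
      ≡⟨ cong (sentAfter H ℕ.+_) (∑-distrib-+ (leftAfter H) (lookup p)) ⟩
    sentAfter H ℕ.+ (sum (leftAfter H) ℕ.+ sum (lookup p))     ≡⟨ sym (ℕ.+-assoc (sentAfter H) _ _) ⟩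
    (sentAfter H ℕ.+ sum (leftAfter H)) ℕ.+ sum (lookup p)     ≤⟨ ℕ.+-monoˡ-≤ _ (sent≤total H) ⟩
    total (map proj₁ H) ℕ.+ sum (lookup p)                   ∎
    where
    open ℕ.≤-Reasoning
    q = queueAfter H p

  -- The same computation with equality, since the cap `B` never cuts anything off. A lossless
  -- script that ends empty therefore attains the bound.
  sent≡total : ∀ H → Lossless H → sentAfter H ℕ.+ sum (leftAfter H) ≡ total (map proj₁ H)
  sent≡total [] _ = sum-replicate-zero m
  sent≡total ((p , s) ∷ H) (lossless , fits) = begin
    (sentAfter H ℕ.+ served s q) ℕ.+ sum (serve s q)           ≡⟨ ℕ.+-assoc (sentAfter H) _ _ ⟩
    sentAfter H ℕ.+ (served s q ℕ.+ sum (serve s q))           ≡⟨ cong (sentAfter H ℕ.+_) (sum-serve s q) ⟩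
    sentAfter H ℕ.+ sum q
      ≡⟨ cong (sentAfter H ℕ.+_) (sum-cong-≗ (λ i → ℕ.m≥n⇒m⊓n≡n (fits i))) ⟩
    sentAfter H ℕ.+ sum (λ i → leftAfter H i ℕ.+ lookup p i)
      ≡⟨ cong (sentAfter H ℕ.+_) (∑-distrib-+ (leftAfter H) (lookup p)) ⟩
    sentAfter H ℕ.+ (sum (leftAfter H) ℕ.+ sum (lookup p))     ≡⟨ sym (ℕ.+-assoc (sentAfter H) _ _) ⟩
    (sentAfter H ℕ.+ sum (leftAfter H)) ℕ.+ sum (lookup p)     ≡⟨ cong (ℕ._+ _) (sent≡total H lossless) ⟩
    total (map proj₁ H) ℕ.+ sum (lookup p)                   ∎
    where
    open ≡-Reasoning
    q = queueAfter H p

-- From scripts to inputs and schedules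

injection-none : ∀ {m} (σ : Input m) t → length σ ≤ t → injection σ t ≡ none
injection-none []      t       _       = refl
injection-none (p ∷ σ) (suc t) (s≤s ≤t) = injection-none σ t ≤t

past-beyond : ∀ {m} (σ : Input m) n → past σ (n ℕ.+ length σ) ≡ replicate n none ++ past σ (length σ)
past-beyond σ zero    = refl
past-beyond σ (suc n) = cong₂ _∷_ (injection-none σ (n ℕ.+ length σ) (ℕ.m≤n+m (length σ) n)) (past-beyond σ n)

sum-none : ∀ m → sum (lookup (none {m})) ≡ 0
sum-none m = trans (sum-cong-≗ {m} {lookup none} {λ _ → 0} (λ i → Vec.lookup-replicate i 0)) (sum-replicate-zero m)

-- The total grows with time and stands still once the input is over. Passing through time
-- `length σ + n` covers `n` before and after the end alike.
total-past : ∀ {m} (σ : Input m) n → total (past σ n) ≤ total (past σ (length σ))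
total-past {m} σ n = begin
  total (past σ n)                                      ≤⟨ more (length σ) ⟩
  total (past σ (length σ ℕ.+ n))                         ≡⟨ cong (total ∘ past σ) (ℕ.+-comm (length σ) n) ⟩
  total (past σ (n ℕ.+ length σ))                         ≡⟨ cong total (past-beyond σ n) ⟩
  total (replicate n none ++ past σ (length σ))         ≡⟨ silent n ⟩
  total (past σ (length σ))                             ∎
  where
  open ℕ.≤-Reasoning
  more : ∀ k → total (past σ n) ≤ total (past σ (k ℕ.+ n))
  more zero    = ℕ.≤-refl
  more (suc k) = ℕ.≤-trans (more k) (ℕ.m≤m+n _ _)
  silent : ∀ n {h} → total (replicate n (none {m}) ++ h) ≡ total h
  silent zero    = refl
  silent (suc n) = trans (cong₂ ℕ._+_ (silent n) (sum-none m)) (ℕ.+-identityʳ _)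

at : ∀ {A : Set} → A → List A → ℕ → A
at d []       t       = d
at d (x ∷ xs) zero    = x
at d (x ∷ xs) (suc t) = at d xs t

history-cong : ∀ {A : Set} {f g : ℕ → A} → f ≗ g → history f ≗ history g
history-cong f≗g zero    = refl
history-cong f≗g (suc n) = cong₂ _∷_ (f≗g n) (history-cong f≗g n)

-- Histories have the most recent entry first, hence the reversal.
history-at : ∀ {A : Set} (d : A) xs → history (at d xs) (length xs) ≡ reverse xs
history-at d []       = refl
history-at d (x ∷ xs) = begin
  history (at d (x ∷ xs)) (suc (length xs))  ≡⟨ oldest (at d (x ∷ xs)) (length xs) ⟩
  history (at d xs) (length xs) ∷ʳ x         ≡⟨ cong (_∷ʳ x) (history-at d xs) ⟩
  reverse xs ∷ʳ x                            ≡⟨ sym (List.unfold-reverse x xs) ⟩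
  reverse (x ∷ xs)                           ∎
  where
  open ≡-Reasoning
  oldest : ∀ {A : Set} (f : ℕ → A) n → history f (suc n) ≡ history (f ∘ suc) n ∷ʳ f 0
  oldest f zero    = refl
  oldest f (suc n) = cong (f (suc n) ∷_) (oldest f n)

some-positive : ∀ {m} (p : Injection m) → 0 ℕ.< sum (lookup p) → Vec.Any (0 ℕ.<_) p
some-positive (zero  ∷ p) 0<p = Vec.there (some-positive p 0<p)
some-positive (suc n ∷ p) 0<p = Vec.here (s≤s z≤n)

some-packet : ∀ {m} (h : List (Injection m)) → 0 ℕ.< total h → List.Any (Vec.Any (0 ℕ.<_)) h
some-packet (p ∷ h) 0<h with sum (lookup p) in eq
... | zero  = there (some-packet h (subst (0 ℕ.<_) (ℕ.+-identityʳ _) 0<h))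
... | suc n = here (some-positive p (subst (0 ℕ.<_) (sym eq) (s≤s z≤n)))

module _ {m : ℕ} (H : Script m) where

  inputOf : Input m
  inputOf = map proj₁ (reverse H)

  scheduleOf : Schedule m
  scheduleOf t = proj₂ (at (none , nothing) (reverse H) t)

  injection-inputOf : ∀ t → injection inputOf t ≡ proj₁ (at (none , nothing) (reverse H) t)
  injection-inputOf = go (reverse H)
    where
    go : ∀ X t → injection (map proj₁ X) t ≡ proj₁ (at (none {m} , nothing) X t)
    go []      t       = refl
    go (_ ∷ X) zero    = refl
    go (_ ∷ X) (suc t) = go X t

  length-inputOf : length inputOf ≡ length (reverse H)
  length-inputOf = List.length-map proj₁ (reverse H)

  script-inputOf : ∀ B → Offline.script B scheduleOf inputOf (length inputOf) ≡ H
  script-inputOf B = begin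
    history (λ t → injection inputOf t , scheduleOf t) (length inputOf)
      ≡⟨ history-cong (λ t → cong (_, scheduleOf t) (injection-inputOf t)) (length inputOf) ⟩
    history (at (none , nothing) (reverse H)) (length inputOf)
      ≡⟨ cong (history (at (none , nothing) (reverse H))) length-inputOf ⟩
    history (at (none , nothing) (reverse H)) (length (reverse H))
      ≡⟨ history-at (none , nothing) (reverse H) ⟩
    reverse (reverse H)
      ≡⟨ List.reverse-involutive H ⟩
    H ∎
    where open ≡-Reasoning

  past-inputOf : past inputOf (length inputOf) ≡ map proj₁ H
  past-inputOf = trans (Offline.past≡ 0 scheduleOf inputOf (length inputOf)) (cong (map proj₁) (script-inputOf 0))

  -- A schedule that loses nothing and ends with empty buffers sends every injected packet, and no
  -- schedule can send more.
  optimum : ∀ B → Offline.Lossless B H → sum (Offline.leftAfter B H) ≡ 0 →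
            IsOptimum B inputOf (Offline.sentAfter B H)
  optimum B lossless empty =
    (scheduleOf , length inputOf , trans (sent≡ scheduleOf inputOf (length inputOf)) (cong sentAfter (script-inputOf B)))
    , λ s n → begin
        sent B s inputOf n                         ≡⟨ sent≡ s inputOf n ⟩
        sentAfter (script s inputOf n)             ≤⟨ ℕ.m≤m+n _ _ ⟩
        sentAfter (script s inputOf n) ℕ.+ sum (leftAfter (script s inputOf n)) ≤⟨ sent≤total (script s inputOf n) ⟩
        total (map proj₁ (script s inputOf n))     ≡⟨ cong total (past≡ s inputOf n) ⟨
        total (past inputOf n)                     ≤⟨ total-past inputOf n ⟩
        total (past inputOf (length inputOf))      ≡⟨ cong total past-inputOf ⟩
        total (map proj₁ H)                        ≡⟨ sent≡total H lossless ⟨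
        sentAfter H ℕ.+ sum (leftAfter H)            ≡⟨ cong (sentAfter H ℕ.+_) empty ⟩
        sentAfter H ℕ.+ 0                            ≡⟨ ℕ.+-identityʳ _ ⟩
        sentAfter H                                ∎
    where
    open ℕ.≤-Reasoning
    open Offline B

  hasPacket : 0 ℕ.< total (map proj₁ H) → HasPacket inputOf
  hasPacket 0<H = subst HasPacket (sym (List.reverse-map proj₁ H)) (List.reverse⁺ (some-packet (map proj₁ H) 0<H))

-- Emptying buffers while nothing is injected

-- The passing of time as the algorithm sees it. The second component is the injection not yet
-- answered: the first step consumes it, the later ones consume `none`.
idle : ∀ {m} → ℕ → List (Injection m) × Injection m → List (Injection m) × Injection m
idle zero    x       = x
idle (suc k) (h , p) = idle k (p ∷ h , none)

idle-+ : ∀ {m} j k (x : List (Injection m) × Injection m) → idle (j ℕ.+ k) x ≡ idle k (idle j x)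
idle-+ zero    k x       = refl
idle-+ (suc j) k (h , p) = idle-+ j k (p ∷ h , none)

serve≤ : ∀ {m} s (q : Fin m → ℕ) j → serve s q j ≤ q j
serve≤ nothing  q j = ℕ.≤-refl
serve≤ (just i) q j with i Fin.≟ j
... | yes refl = ℕ.≤-trans (ℕ.≤-reflexive (updateAt-updates i q)) ℕ.pred[n]≤n
... | no i≢j   = ℕ.≤-reflexive (updateAt-minimal j i q (i≢j ∘ sym))

module Draining {m : ℕ} (B : ℕ) where

  open Offline {m} B

  -- A script together with the injection that comes next.
  State : Set
  State = Script m × Injection m

  forget : State → List (Injection m) × Injection m
  forget (H , p) = map proj₁ H , p

  queueOf : State → Fin m → ℕ
  queueOf (H , p) = queueAfter H p

  -- The pending injection is included. Whether it fits is settled before the step after it, so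
  -- `nothing` can stand for the service still to be chosen.
  Feasible : State → Set
  Feasible (H , p) = Lossless ((p , nothing) ∷ H)

  drainOne : ℕ → Fin m → State → State
  drainOne zero    i st      = st
  drainOne (suc k) i (H , p) = drainOne k i ((p , just i) ∷ H , none)

  drain : List (Fin m) → State → State
  drain []      st = st
  drain (i ∷ D) st = drain D (drainOne B i st)

  queue-step : ∀ H p s j → queueAfter ((p , s) ∷ H) none j ≡ serve s (queueAfter H p) j
  queue-step H p s j = trans
    (cong (λ l → B ℕ.⊓ (serve s (queueAfter H p) j ℕ.+ l)) (Vec.lookup-replicate j 0))
    (trans (cong (B ℕ.⊓_) (ℕ.+-identityʳ _))
      (ℕ.m≥n⇒m⊓n≡n (ℕ.≤-trans (serve≤ s (queueAfter H p) j) (ℕ.m⊓n≤m B _))))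

  feasible-step : ∀ H p s → Feasible (H , p) → Feasible ((p , s) ∷ H , none)
  feasible-step H p s feasible = feasible , λ j → subst (_≤ B)
    (sym (trans (cong (serve s (queueAfter H p) j ℕ.+_) (Vec.lookup-replicate j 0)) (ℕ.+-identityʳ _)))
    (ℕ.≤-trans (serve≤ s (queueAfter H p) j) (ℕ.m⊓n≤m B _))

  drainOne-forget : ∀ k i st → forget (drainOne k i st) ≡ idle k (forget st)
  drainOne-forget zero    i st      = refl
  drainOne-forget (suc k) i (H , p) = drainOne-forget k i ((p , just i) ∷ H , none)

  -- The algorithm cannot see which buffers are being emptied: only the length of `D` leaves a
  -- trace. This is what allows the adversary to choose the block in hindsight.
  drain-forget : ∀ D st → forget (drain D st) ≡ idle (length D ℕ.* B) (forget st)
  drain-forget []      st = refl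
  drain-forget (i ∷ D) st = trans (drain-forget D (drainOne B i st))
    (trans (cong (idle (length D ℕ.* B)) (drainOne-forget B i st))
           (sym (idle-+ B (length D ℕ.* B) (forget st))))

  drainOne-feasible : ∀ k i st → Feasible st → Feasible (drainOne k i st)
  drainOne-feasible zero    i st      feasible = feasible
  drainOne-feasible (suc k) i (H , p) feasible =
    drainOne-feasible k i ((p , just i) ∷ H , none) (feasible-step H p (just i) feasible)

  drain-feasible : ∀ D st → Feasible st → Feasible (drain D st)
  drain-feasible []      st feasible = feasible
  drain-feasible (i ∷ D) st feasible = drain-feasible D (drainOne B i st) (drainOne-feasible B i st feasible)

  drainOne-other : ∀ k i st j → j ≢ i → queueOf (drainOne k i st) j ≡ queueOf st j
  drainOne-other zero    i st      j j≢i = refl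
  drainOne-other (suc k) i (H , p) j j≢i = trans (drainOne-other k i ((p , just i) ∷ H , none) j j≢i)
    (trans (queue-step H p (just i) j) (updateAt-minimal j i (queueAfter H p) j≢i))

  drain-other : ∀ D st j → j ∉ D → queueOf (drain D st) j ≡ queueOf st j
  drain-other []      st j j∉D = refl
  drain-other (i ∷ D) st j j∉D = trans (drain-other D (drainOne B i st) j (j∉D ∘ there))
    (drainOne-other B i st j (j∉D ∘ here))

  drainOne-queue : ∀ k i st → queueOf st i ≡ k → queueOf (drainOne k i st) i ≡ 0
  drainOne-queue zero    i st      q≡k = q≡k
  drainOne-queue (suc k) i (H , p) q≡k = drainOne-queue k i ((p , just i) ∷ H , none)
    (trans (queue-step H p (just i) i) (trans (updateAt-updates i (queueAfter H p)) (cong ℕ.pred q≡k)))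

  drainOne-sent : ∀ k i st → queueOf st i ≡ k →
                  sentAfter (proj₁ (drainOne k i st)) ≡ sentAfter (proj₁ st) ℕ.+ k
  drainOne-sent zero    i st      q≡k = sym (ℕ.+-identityʳ _)
  drainOne-sent (suc k) i (H , p) q≡k = trans
    (drainOne-sent k i ((p , just i) ∷ H , none)
      (trans (queue-step H p (just i) i) (trans (updateAt-updates i (queueAfter H p)) (cong ℕ.pred q≡k))))
    (trans (cong (λ q → sentAfter H ℕ.+ 1 ℕ.⊓ q ℕ.+ k) q≡k) (ℕ.+-assoc (sentAfter H) 1 k))

  drain-queue : ∀ D st → Unique D → (∀ {i} → i ∈ D → queueOf st i ≡ B) →
                ∀ {j} → j ∈ D → queueOf (drain D st) j ≡ 0
  drain-queue (i ∷ D) st (i∉D ∷ _) full (here refl) = trans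
    (drain-other D (drainOne B i st) i (λ i∈D → All.lookup i∉D i∈D refl))
    (drainOne-queue B i st (full (here refl)))
  drain-queue (i ∷ D) st (i∉D ∷ D!) full (there j∈D) = drain-queue D (drainOne B i st) D!
    (λ {k} k∈D → trans (drainOne-other B i st k (λ k≡i → All.lookup i∉D k∈D (sym k≡i))) (full (there k∈D))) j∈D

  drain-sent : ∀ D st → Unique D → (∀ {i} → i ∈ D → queueOf st i ≡ B) →
               sentAfter (proj₁ (drain D st)) ≡ sentAfter (proj₁ st) ℕ.+ length D ℕ.* B
  drain-sent []      st D! full = sym (ℕ.+-identityʳ _)
  drain-sent (i ∷ D) st (i∉D ∷ D!) full = trans
    (drain-sent D (drainOne B i st) D!
      (λ {k} k∈D → trans (drainOne-other B i st k (λ k≡i → All.lookup i∉D k∈D (sym k≡i))) (full (there k∈D))))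
    (trans (cong (ℕ._+ length D ℕ.* B) (drainOne-sent B i st (full (here refl))))
      (ℕ.+-assoc (sentAfter (proj₁ st)) B (length D ℕ.* B)))

-- Partitions of the set of buffers

unique-++ : ∀ {A : Set} (D : List A) {E} → Unique (D ++ E) → Unique D × (∀ {j} → j ∈ E → j ∉ D)
unique-++ []      _           = [] , λ _ ()
unique-++ (i ∷ D) (i∉ ∷ DE!) =
  let D! , E∌ = unique-++ D DE!
  in All.++⁻ˡ D i∉ ∷ D!
   , λ { j∈E (here refl) → All.lookup (All.++⁻ʳ D i∉) j∈E refl
       ; j∈E (there j∈D) → E∌ j∈E j∈D }

split-unique : ∀ {m D E} → D ++ E ↭ allFin m → Unique D × (∀ {j} → j ∈ E → j ∉ D)
split-unique {m} {D} DE↭ = unique-++ D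
  (↭ₛ.Unique-resp-↭ (setoid (Fin m)) (↭⇒↭ₛ (↭-sym DE↭)) (allFin⁺ m))

sumᵣ≡∑ : ∀ {m} (f : Fin m → ℝ) n → seq (sumᵣ f) n ≡ seq (∑ (allFin m) f) n
sumᵣ≡∑ f n = go f id
  where
  go : ∀ {k m} (f : Fin m → ℝ) (g : Fin k → Fin m) → seq (sumᵣ (f ∘ g)) n ≡ seq (∑ (tabulate g) f) n
  go {zero}  f g = refl
  go {suc k} f g = cong (seq (f (g zero)) n +_) (go f (g ∘ suc))

-- Amounts accepted by the online algorithm

module Online {m B : ℕ} (A : FractionalAlgorithm m B) where

  sentFrom : List (Injection m) → Fin m → ℝ
  sentFrom []      i = 0ᵣ
  sentFrom (p ∷ h) i = sentFrom h i +ᵣ policy A p h i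

  loadAt : List (Injection m) × Injection m → Fin m → ℝ
  loadAt (h , p) = load B (policy A) p h

  -- The potential of the argument: it does not grow while nothing is injected, and at the end it
  -- bounds the throughput.
  accepted : List (Injection m) × Injection m → Fin m → ℝ
  accepted (h , p) i = loadAt (h , p) i +ᵣ sentFrom h i

  -- Sending moves load into `sentFrom` and keeps the sum. Term by term only an inequality is
  -- available: a single term of the policy may be negative, and then the cap `B` can cut load off.
  accepted-step : ∀ h p i n → seq (accepted (p ∷ h , none) i) n ℚ.≤ seq (accepted (h , p) i) n
  accepted-step h p i n = ℚ.≤-trans
    (ℚ.+-monoˡ-≤ (s + x) (ℚ.p⊓q≤q (ℤ.+ B ℚ./ 1) _))
    (ℚ.≤-reflexive (trans
      (cong (λ k → ((l - x) + ℤ.+ k ℚ./ 1) + (s + x)) (Vec.lookup-replicate i 0))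
      (S.solve 3 (λ l s x → ((l S.:- x) S.:+ S.con 0ℚ) S.:+ (s S.:+ x) S.:= l S.:+ s) refl l s x)))
    where
    l = seq (loadAt (h , p) i) n
    s = seq (sentFrom h i) n
    x = seq (policy A p h i) n

  accepted-idle : ∀ k x i n → seq (accepted (idle k x) i) n ℚ.≤ seq (accepted x i) n
  accepted-idle zero    x       i n = ℚ.≤-refl
  accepted-idle (suc k) (h , p) i n = ℚ.≤-trans (accepted-idle k (p ∷ h , none) i n) (accepted-step h p i n)

  sentFrom-mono : ∀ p h i → seq (sentFrom h i) ≲ seq (sentFrom (p ∷ h) i)
  sentFrom-mono p h i = ≲-trans (≡⇒≲ (λ n → sym (ℚ.+-identityʳ _)))
    (≲-+ (≲-refl {seq (sentFrom h i)}) (≤ᵣ⇒≲ 0ᵣ (policy A p h i) (nonNegative A p h i)))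

  -- The load is nonnegative because it dominates the nonnegative policy.
  sentFrom≲accepted : ∀ x i → seq (sentFrom (proj₁ x) i) ≲ seq (accepted x i)
  sentFrom≲accepted (h , p) i = ≲-trans (≡⇒≲ (λ n → sym (ℚ.+-identityˡ _)))
    (≲-+ (≲-trans (≤ᵣ⇒≲ 0ᵣ (policy A p h i) (nonNegative A p h i)) (≤ᵣ⇒≲ (policy A p h i) (loadAt (h , p) i) (available A p h i))) ≲-refl)

  0≲∑ : ∀ E (f : Fin m → ℝ) → (∀ i → 0ᵣ ≤ᵣ f i) → (λ _ → 0ℚ) ≲ seq (∑ E f)
  0≲∑ []      f 0≤f = ≲-refl
  0≲∑ (i ∷ E) f 0≤f = ≲-trans (≡⇒≲ (λ n → sym (ℚ.+-identityˡ 0ℚ))) (≲-+ (≤ᵣ⇒≲ 0ᵣ (f i) (0≤f i)) (0≲∑ E f 0≤f))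

  policy-rate : ∀ {S E} → S ++ E ↭ allFin m → ∀ p h → seq (∑ S (policy A p h)) ≲ (λ _ → 1ℚ)
  policy-rate {S} {E} SE↭ p h =
    ≲-trans (≡⇒≲ (λ n → sym (ℚ.+-identityʳ _)))
      (≲-trans (≲-+ {seq (∑ S f)} ≲-refl (0≲∑ E f (nonNegative A p h)))
        (≲-trans (≡⇒≲ (λ n → trans (sym (∑-++ S E f n)) (trans (∑-↭ SE↭ f n) (sym (sumᵣ≡∑ f n)))))
          (≤ᵣ⇒≲ (sumᵣ f) 1ᵣ (total≤1 A p h))))
    where f = policy A p h

  idle-rate : ∀ {S E} → S ++ E ↭ allFin m → ∀ k x →
    seq (∑ S (sentFrom (proj₁ (idle k x)))) ≲ (λ n → seq (∑ S (sentFrom (proj₁ x))) n + ι k)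
  idle-rate {S} SE↭ zero    x       = ≡⇒≲ (λ n → sym (trans (cong (seq (∑ S (sentFrom (proj₁ x))) n +_) ι-0) (ℚ.+-identityʳ _)))
  idle-rate {S} {E} SE↭ (suc k) (h , p) =
    ≲-trans (idle-rate {S} {E} SE↭ k (p ∷ h , none))
      (≲-trans (≲-+ {f′ = λ _ → ι k} {g′ = λ _ → ι k}
                  (≲-trans (≡⇒≲ (∑-+ S (sentFrom h) (policy A p h)))
                    (≲-+ {seq (∑ S (sentFrom h))} ≲-refl (policy-rate {S} {E} SE↭ p h))) ≲-refl)
        (≡⇒≲ (λ n → trans (ℚ.+-assoc (seq (∑ S (sentFrom h)) n) 1ℚ (ι k))
          (cong (seq (∑ S (sentFrom h)) n +_) (sym (trans (ι-+ 1 k) (cong (_+ ι k) ι-1)))))))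

  transmitted≡ : ∀ σ n k → seq (transmitted A σ n) k ≡ seq (∑ (allFin m) (sentFrom (past σ n))) k
  transmitted≡ σ zero    k = sym (∑-0 (allFin m) k)
  transmitted≡ σ (suc n) k = trans
    (cong₂ _+_ (transmitted≡ σ n k) (sumᵣ≡∑ (policy A (injection σ n) (past σ n)) k))
    (sym (∑-+ (allFin m) (sentFrom (past σ n)) (policy A (injection σ n) (past σ n)) k))

  -- The amount sent only grows up to time `n + length σ`, where it is at most the amount accepted;
  -- and that has not grown since the input ended.
  transmitted≲ : ∀ σ n → seq (transmitted A σ n) ≲ seq (∑ (allFin m) (accepted (past σ (length σ) , none)))
  transmitted≲ σ n =
    ≲-trans (≡⇒≲ (transmitted≡ σ n))
      (≲-trans (later (length σ))
        (≲-trans (≡⇒≲ (λ k → cong (λ h → seq (∑ (allFin m) (sentFrom h)) k)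
                   (trans (cong (past σ) (ℕ.+-comm (length σ) n)) (past-beyond σ n))))
          (≲-trans (∑-mono-≲ (allFin m) (sentFrom padded) (accepted (padded , none)) (sentFrom≲accepted (padded , none)))
            (≤⇒≲ λ k → ∑-mono-≤ (allFin m) _ _ k (λ {i} _ → silent n i k)))))
    where
    padded = replicate n none ++ past σ (length σ)
    later : ∀ j → seq (∑ (allFin m) (sentFrom (past σ n))) ≲ seq (∑ (allFin m) (sentFrom (past σ (j ℕ.+ n))))
    later zero    = ≲-refl
    later (suc j) = ≲-trans (later j) (∑-mono-≲ (allFin m) _ _ (sentFrom-mono (injection σ (j ℕ.+ n)) (past σ (j ℕ.+ n))))
    silent : ∀ n {h} i k → seq (accepted (replicate n none ++ h , none) i) k ℚ.≤ seq (accepted (h , none) i) k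
    silent zero    i k = ℚ.≤-refl
    silent (suc n) i k = ℚ.≤-trans (accepted-step _ none i k) (silent n i k)

  ∑load≤ : ∀ S x n → seq (∑ S (loadAt x)) n ℚ.≤ ι (length S ℕ.* B)
  ∑load≤ []      x n = ℚ.≤-reflexive (sym ι-0)
  ∑load≤ (i ∷ S) x@(h , p) n = subst (seq (∑ (i ∷ S) (loadAt x)) n ℚ.≤_) (sym (ι-+ B (length S ℕ.* B)))
    (ℚ.+-mono-≤ (subst (seq (loadAt x i) n ℚ.≤_) (sym (ι-def B)) (ℚ.p⊓q≤p (ℤ.+ B ℚ./ 1) _)) (∑load≤ S x n))

-- Inequalities and recursions for one round

cancel : ∀ {f g} (h : ℕ → ℚ) → (λ n → f n + h n) ≲ (λ n → g n + h n) → f ≲ g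
cancel {f} {g} h f+h≲g+h = ≲-trans (≡⇒≲ (λ n → drop-last (f n) (h n)))
  (≲-trans (≲-+ {f′ = λ n → ℚ.- h n} f+h≲g+h ≲-refl) (≡⇒≲ (λ n → sym (drop-last (g n) (h n)))))
  where
  drop-last : ∀ a b → a ≡ (a + b) + ℚ.- b
  drop-last = S.solve 2 (λ a b → a S.:= (a S.:+ b) S.:+ (S.:- b)) refl

module Rounds (B c : ℕ) where

  -- At least 2, so that the weight `1ℚ - η` in `combine` is positive.
  K : ℕ
  K = suc (suc c)

  0<K : 0ℚ ℚ.< ι K
  0<K = 0<ι (s≤s z≤n)

  η : ℚ
  η = recip (ι K)

  0<η : 0ℚ ℚ.< η
  0<η = recip-pos (ι K) 0<K

  η*K : η * ι K ≡ 1ℚ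
  η*K = trans (ℚ.*-comm η (ι K)) (recip-inverse (ι K) 0<K)

  0<1-η : 0ℚ ℚ.< 1ℚ - η
  0<1-η = subst (0ℚ ℚ.<_) eq (*-pos 0<η (0<ι {suc c} (s≤s z≤n)))
    where
    eq : η * ι (suc c) ≡ 1ℚ - η
    eq = trans
      (S.solve 2 (λ h x → h S.:* x S.:= h S.:* (S.con 1ℚ S.:+ x) S.:- h) refl η (ι (suc c)))
      (cong (_- η) (trans (cong (η *_) (sym (trans (ι-+ 1 (suc c)) (cong (_+ ι (suc c)) ι-1)))) η*K))

  -- L = L₁ + L₂ and Sₙ = S₁ + S₂ are the load of a set of buffers and the amount
  -- sent from it when the block is chosen, split into block and rest; X is what
  -- the set has accepted at the end of the round.  With the weights 1, η, 1 - η
  -- and η of the four inequalities, L and Sₙ cancel.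
  combine : ∀ {X L Sₙ L₁ L₂ S₁ S₂ s : ℕ → ℚ} b₁ b₂ ρ T →
    (∀ n → L n ≡ L₁ n + L₂ n) → (∀ n → Sₙ n ≡ S₁ n + S₂ n) →
    X ≲ (λ n → (S₁ n + (b₂ + ρ)) + (L₂ n + S₂ n)) →
    L ≲ (λ n → ι K * L₁ n + ρ) →
    (λ n → L n + Sₙ n) ≲ (λ n → s n + (b₁ + ρ)) →
    Sₙ ≲ (λ n → s n + T) →
    X ≲ (λ n → s n + (((1ℚ - η) * b₁ + η * T + b₂) + (ρ + ρ)))
  combine {X} {L} {Sₙ} {L₁} {L₂} {S₁} {S₂} {s} b₁ b₂ ρ T L≡ S≡ X≲ L≲ L+S≲ S≲ =
    cancel (λ n → L n + Sₙ n)
      (≲-trans (≡⇒≲ (λ n → left-side (X n) (L n) (Sₙ n)))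
        (≲-trans (≲-+ (≲-+ X≲ (≲-* η 0<η L≲)) (≲-+ (≲-* (1ℚ - η) 0<1-η L+S≲) (≲-* η 0<η S≲)))
          (≡⇒≲ (λ n → trans (right-side (S₁ n) (S₂ n) (L₁ n) (L₂ n) (s n) (ι K))
            (trans (cong (λ x → (s n + (((1ℚ - η) * b₁ + η * T + b₂) + (ρ + ρ))) + ((x * L₁ n + L₂ n) + (S₁ n + S₂ n))) η*K)
              (cong₂ (λ x y → (s n + (((1ℚ - η) * b₁ + η * T + b₂) + (ρ + ρ))) + (x + y))
                (trans (cong (_+ L₂ n) (ℚ.*-identityˡ (L₁ n))) (sym (L≡ n))) (sym (S≡ n))))))))
    where
    left-side : ∀ x l z → x + (l + z) ≡ (x + η * l) + ((1ℚ - η) * (l + z) + η * z)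
    left-side x l z = S.solve 4 (λ h x l z → x S.:+ (l S.:+ z) S.:=
      (x S.:+ h S.:* l) S.:+ ((S.con 1ℚ S.:- h) S.:* (l S.:+ z) S.:+ h S.:* z)) refl η x l z
    right-side : ∀ s₁ s₂ l₁ l₂ s k →
      (((s₁ + (b₂ + ρ)) + (l₂ + s₂)) + η * (k * l₁ + ρ)) + ((1ℚ - η) * (s + (b₁ + ρ)) + η * (s + T)) ≡
      (s + (((1ℚ - η) * b₁ + η * T + b₂) + (ρ + ρ))) + (((η * k) * l₁ + l₂) + (s₁ + s₂))
    right-side s₁ s₂ l₁ l₂ s k = S.solve 11 (λ s₁ s₂ l₁ l₂ s k b₁ b₂ r t h →
      (((s₁ S.:+ (b₂ S.:+ r)) S.:+ (l₂ S.:+ s₂)) S.:+ h S.:* (k S.:* l₁ S.:+ r))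
        S.:+ ((S.con 1ℚ S.:- h) S.:* (s S.:+ (b₁ S.:+ r)) S.:+ h S.:* (s S.:+ t)) S.:=
      (s S.:+ (((S.con 1ℚ S.:- h) S.:* b₁ S.:+ h S.:* t S.:+ b₂) S.:+ (r S.:+ r)))
        S.:+ (((h S.:* k) S.:* l₁ S.:+ l₂) S.:+ (s₁ S.:+ s₂))) refl s₁ s₂ l₁ l₂ s k b₁ b₂ ρ T η

  -- Duration of k levels of the attack on K ^ k * u buffers.
  time : ℕ → ℕ → ℕ
  time zero    u = 0
  time (suc k) u = time k (K ℕ.* u) ℕ.+ (K ℕ.^ k ℕ.* u) ℕ.* B ℕ.+ time k u

  -- What such an attack lets the algorithm accept, counting the amount sent
  -- during the attack and the load at its end.
  bound : ℕ → ℕ → ℚ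
  bound zero    u = ι (u ℕ.* B)
  bound (suc k) u = (1ℚ - η) * bound k (K ℕ.* u)
                  + η * ι (time k (K ℕ.* u) ℕ.+ (K ℕ.^ k ℕ.* u) ℕ.* B) + bound k u

-- The recursive attack

module Adversary {m B : ℕ} (c : ℕ) (1≤B : 1 ≤ B) (A : FractionalAlgorithm m B) where

  open Offline {m} B
  open Draining {m} B
  open Online A
  open Rounds B c

  acceptedIn : State → Fin m → ℝ
  acceptedIn st = accepted (forget st)

  sentIn : State → Fin m → ℝ
  sentIn st = sentFrom (proj₁ (forget st))

  Full : List (Fin m) → State → Set
  Full S st = ∀ {i} → i ∈ S → queueOf st i ≡ B

  -- The buffers in E are neither injected into nor served meanwhile.
  record Evolves (E : List (Fin m)) (T : ℕ) (st st′ : State) : Set where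
    field
      feasible  : Feasible st → Feasible st′
      sends     : sentAfter (proj₁ st′) ≡ sentAfter (proj₁ st) ℕ.+ T
      untouched : ∀ {j} → j ∈ E → queueOf st′ j ≡ queueOf st j
      accepts   : ∀ {j} → j ∈ E → ∀ n → seq (acceptedIn st′ j) n ℚ.≤ seq (acceptedIn st j) n
      rate      : ∀ {S R} → S ++ R ↭ allFin m →
                  seq (∑ S (sentIn st′)) ≲ (λ n → seq (∑ S (sentIn st)) n + ι T)

  open Evolves

  evolves-refl : ∀ {E st} → Evolves E 0 st st
  evolves-refl .feasible      = id
  evolves-refl .sends         = sym (ℕ.+-identityʳ _)
  evolves-refl .untouched _   = refl
  evolves-refl .accepts _ _   = ℚ.≤-refl
  evolves-refl {st = st} .rate {S} {R} SR↭ = idle-rate {S} {R} SR↭ 0 (forget st)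

  evolves-trans : ∀ {E T T′ st st′ st″} → Evolves E T st st′ → Evolves E T′ st′ st″ →
                  Evolves E (T ℕ.+ T′) st st″
  evolves-trans p q .feasible        = q .feasible ∘ p .feasible
  evolves-trans {T = T} {T′} p q .sends = trans (q .sends)
    (trans (cong (ℕ._+ T′) (p .sends)) (ℕ.+-assoc _ T T′))
  evolves-trans p q .untouched j∈E   = trans (q .untouched j∈E) (p .untouched j∈E)
  evolves-trans p q .accepts j∈E n   = ℚ.≤-trans (q .accepts j∈E n) (p .accepts j∈E n)
  evolves-trans {T = T} {T′} {st} p q .rate {S} {R} SR↭ =
    ≲-trans (q .rate {S} {R} SR↭)
      (≲-trans (≲-+ {f′ = λ _ → ι T′} (p .rate {S} {R} SR↭) ≲-refl)
        (≡⇒≲ (λ n → trans (ℚ.+-assoc (seq (∑ S (sentIn st)) n) (ι T) (ι T′))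
          (cong (seq (∑ S (sentIn st)) n +_) (sym (ι-+ T T′))))))

  evolves-⊇ : ∀ {E E′ T st st′} → (∀ {j} → j ∈ E → j ∈ E′) → Evolves E′ T st st′ → Evolves E T st st′
  evolves-⊇ E⊆E′ p .feasible      = p .feasible
  evolves-⊇ E⊆E′ p .sends         = p .sends
  evolves-⊇ E⊆E′ p .untouched j∈E = p .untouched (E⊆E′ j∈E)
  evolves-⊇ E⊆E′ p .accepts j∈E   = p .accepts (E⊆E′ j∈E)
  evolves-⊇ E⊆E′ p .rate {S} {R}  = p .rate {S} {R}

  drain-evolves : ∀ {D E st} → D ++ E ↭ allFin m → Full D st → Evolves E (length D ℕ.* B) st (drain D st)
  drain-evolves {D} {st = st} DE↭ full .feasible      = drain-feasible D st
  drain-evolves {D} {st = st} DE↭ full .sends         = drain-sent D st (split-unique DE↭ .proj₁) full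
  drain-evolves {D} {st = st} DE↭ full .untouched j∈E = drain-other D st _ (split-unique DE↭ .proj₂ j∈E)
  drain-evolves {D} {st = st} DE↭ full .accepts {j} _ n =
    subst (λ x → seq (accepted x j) n ℚ.≤ seq (acceptedIn st j) n) (sym (drain-forget D st))
      (accepted-idle (length D ℕ.* B) (forget st) j n)
  drain-evolves {D} {st = st} DE↭ full .rate {S} {R} SR↭ =
    subst (λ x → seq (∑ S (sentFrom (proj₁ x))) ≲ (λ n → seq (∑ S (sentIn st)) n + ι (length D ℕ.* B)))
      (sym (drain-forget D st)) (idle-rate {S} {R} SR↭ (length D ℕ.* B) (forget st))

  -- Only the pending injection is changed, so no time passes and the history by which `D` was
  -- chosen remains as it is.
  refill : List (Fin m) → State → State
  refill D (H , p) = H , tabulateᵛ (λ i → if does (_∈?_ Fin._≟_ i D) then B else lookup p i)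

  refill-∈ : ∀ {D i} st → i ∈ D → lookup (proj₂ (refill D st)) i ≡ B
  refill-∈ {D} {i} (H , p) i∈D = trans (Vec.lookup∘tabulate _ i)
    (cong (if_then B else lookup p i) (dec-true (_∈?_ Fin._≟_ i D) i∈D))

  refill-∉ : ∀ {D i} st → i ∉ D → lookup (proj₂ (refill D st)) i ≡ lookup (proj₂ st) i
  refill-∉ {D} {i} (H , p) i∉D = trans (Vec.lookup∘tabulate _ i)
    (cong (if_then B else lookup p i) (dec-false (_∈?_ Fin._≟_ i D) i∉D))

  refill-full : ∀ D st → Full D (refill D st)
  refill-full D st@(H , p) {i} i∈D = trans
    (cong (λ k → B ℕ.⊓ (leftAfter H i ℕ.+ k)) (refill-∈ st i∈D))
    (ℕ.m≤n⇒m⊓n≡m (ℕ.m≤n+m B (leftAfter H i)))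

  -- As `B` is positive, a minimum of 0 cannot come from the cap. Hence a buffer with empty queue
  -- has room for `B` new packets in place of the pending ones.
  queue-empty : ∀ {H p i} → queueOf (H , p) i ≡ 0 → leftAfter H i ≡ 0
  queue-empty {H} {p} {i} q≡0 with leftAfter H i ℕ.+ lookup p i in eq
  ... | zero  = ℕ.m+n≡0⇒m≡0 (leftAfter H i) eq
  ... | suc k = ⊥-elim (ℕ.<-irrefl (sym q≡0) (ℕ.⊓-pres-m< 1≤B (s≤s z≤n)))

  refill-evolves : ∀ {D E st} → D ++ E ↭ allFin m → (∀ {i} → i ∈ D → queueOf st i ≡ 0) →
                   Evolves E 0 st (refill D st)
  refill-evolves {D} {st = H , p} DE↭ empty .feasible (lossless , fits) = lossless , fits′
    where
    fits′ : ∀ i → leftAfter H i ℕ.+ lookup (proj₂ (refill D (H , p))) i ≤ B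
    fits′ i with _∈?_ Fin._≟_ i D
    ... | yes i∈D = ℕ.≤-reflexive (cong₂ ℕ._+_ (queue-empty {H} {p} (empty i∈D)) (refill-∈ (H , p) i∈D))
    ... | no i∉D  = subst (ℕ._≤ B) (cong (leftAfter H i ℕ.+_) (sym (refill-∉ (H , p) i∉D))) (fits i)
  refill-evolves DE↭ empty .sends = sym (ℕ.+-identityʳ _)
  refill-evolves {D} {st = H , p} DE↭ empty .untouched {j} j∈E =
    cong (λ k → B ℕ.⊓ (leftAfter H j ℕ.+ k)) (refill-∉ (H , p) (split-unique DE↭ .proj₂ j∈E))
  refill-evolves {D} {st = st@(H , p)} DE↭ empty .accepts {j} j∈E n = ℚ.≤-reflexive
    (cong (λ k → ℤ.+ B ℚ./ 1 ℚ.⊓ (seq (residual B (policy A) h j) n + ℤ.+ k ℚ./ 1) + seq (sentFrom h j) n)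
      (refill-∉ (H , p) (split-unique DE↭ .proj₂ j∈E)))
    where h = proj₁ (forget st)
  refill-evolves {D} {st = st} DE↭ empty .rate {S} {R} SR↭ = idle-rate {S} {R} SR↭ 0 (forget st)

  -- `τ` collects the errors of the block choices. That `S` is full again at the end allows any
  -- block of it to be emptied next.
  Played : ℕ → ℕ → List (Fin m) → List (Fin m) → ℚ → State → State → Set
  Played k u S E τ st st′ =
    Evolves E (time k u) st st′ × Full S st′ ×
    seq (∑ S (acceptedIn st′)) ≲ (λ n → seq (∑ S (sentIn st)) n + (bound k u + τ))

  split↭ : ∀ {S E D E′} → S ++ E ↭ allFin m → S ↭ D ++ E′ → D ++ (E′ ++ E) ↭ allFin m
  split↭ {E = E} {D} {E′} SE↭ S↭DE′ =
    ↭-trans (↭-sym (↭.++-assoc D E′ E)) (↭-trans (↭.++⁺ʳ E (↭-sym S↭DE′)) SE↭)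

  -- When `D` is refilled, its load drops out of the account and is replaced by what the attack on
  -- `D` brings, at most `b₂`. This load is at least η L, up to errors, where L is the load of `S`.
  -- With Sₙ the amount sent from `S`, there remains L + Sₙ - η L = (1 - η) (L + Sₙ) + η Sₙ, where L
  -- + Sₙ is bounded by `b₁` and Sₙ by `T`.
  accounting : ∀ {S D E′ st st₁ p p′ st₃ b₁ b₂ ρ T} {H : Script m} →
    S ↭ D ++ E′ →
    seq (∑ S (acceptedIn st₁)) ≲ (λ n → seq (∑ S (sentIn st)) n + (b₁ + ρ)) →
    (∀ {j} n → seq (acceptedIn (H , p) j) n ℚ.≤ seq (acceptedIn st₁ j) n) →
    seq (∑ S (sentIn (H , p))) ≲ (λ n → seq (∑ S (sentIn st)) n + T) →
    seq (∑ S (loadAt (forget (H , p)))) ≲ (λ n → ι K * seq (∑ D (loadAt (forget (H , p)))) n + ρ) →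
    seq (∑ D (acceptedIn st₃)) ≲ (λ n → seq (∑ D (sentIn (H , p′))) n + (b₂ + ρ)) →
    (∀ {j} → j ∈ E′ → ∀ n → seq (acceptedIn st₃ j) n ℚ.≤ seq (acceptedIn (H , p) j) n) →
    seq (∑ S (acceptedIn st₃)) ≲
      (λ n → seq (∑ S (sentIn st)) n + (((1ℚ - η) * b₁ + η * T + b₂) + (ρ + ρ)))
  accounting {S} {D} {E′} {st} {st₁} {p} {p′} {st₃} {b₁} {b₂} {ρ} {T} {H} S↭DE′ acc₁ idle₁ rate heavy acc₃ idle₃ =
    combine {seq (∑ S (acceptedIn st₃))} {seq (∑ S l)} {seq (∑ S s)} {seq (∑ D l)} {seq (∑ E′ l)}
      {seq (∑ D s)} {seq (∑ E′ s)} {seq (∑ S (sentIn st))} b₁ b₂ ρ T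
      (λ n → trans (∑-↭ S↭DE′ l n) (∑-++ D E′ l n))
      (λ n → trans (∑-↭ S↭DE′ s n) (∑-++ D E′ s n))
      outside heavy before rate
    where
    l s : Fin m → ℝ
    l = loadAt (forget (H , p))
    s = sentFrom (map proj₁ H)
    outside : seq (∑ S (acceptedIn st₃)) ≲ (λ n → (seq (∑ D s) n + (b₂ + ρ)) + (seq (∑ E′ l) n + seq (∑ E′ s) n))
    outside = ≲-trans (≡⇒≲ λ n → trans (∑-↭ S↭DE′ (acceptedIn st₃) n) (∑-++ D E′ (acceptedIn st₃) n))
      (≲-+ acc₃ (≲-trans
        (≤⇒≲ λ n → ∑-mono-≤ E′ (acceptedIn st₃) (acceptedIn (H , p)) n (λ j∈E′ → idle₃ j∈E′ n))
        (≡⇒≲ (∑-+ E′ l s))))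
    before : (λ n → seq (∑ S l) n + seq (∑ S s) n) ≲ (λ n → seq (∑ S (sentIn st)) n + (b₁ + ρ))
    before = ≲-trans (≡⇒≲ λ n → sym (∑-+ S l s n))
      (≲-trans (≤⇒≲ λ n → ∑-mono-≤ S (acceptedIn (H , p)) (acceptedIn st₁) n (λ _ → idle₁ n)) acc₁)

  play-round : ∀ k u {S E D E′ st st₁ st₃} ρ → S ++ E ↭ allFin m → S ↭ D ++ E′ →
    length D ≡ K ℕ.^ k ℕ.* u →
    Played k (K ℕ.* u) S E ρ st st₁ →
    seq (∑ S (loadAt (idle (K ℕ.^ k ℕ.* u ℕ.* B) (forget st₁)))) ≲
      (λ n → ι K * seq (∑ D (loadAt (idle (K ℕ.^ k ℕ.* u ℕ.* B) (forget st₁)))) n + ρ) →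
    Played k u D (E′ ++ E) ρ (refill D (drain D st₁)) st₃ →
    Played (suc k) u S E (ρ + ρ) st st₃
  play-round k u {S} {E} {D} {E′} {st} {st₁} {st₃} ρ SE↭ S↭DE′ |D| (ev₁ , full₁ , acc₁) heavy (ev₃ , full₃ , acc₃) =
      -- Refilling contributes the duration 0 that is removed here.
      subst (λ T → Evolves E (T ℕ.+ time k u) st st₃) (ℕ.+-identityʳ (time k (K ℕ.* u) ℕ.+ d ℕ.* B))
        (evolves-trans (evolves-trans ev₁₂ (evolves-⊇ (∈.∈-++⁺ʳ E′) ev₂′)) (evolves-⊇ (∈.∈-++⁺ʳ E′) ev₃))
    -- The buffers of `E′` are full after the first attack and untouched from then on.
    , (λ i∈S → full′ st₃ (↭.∈-resp-↭ S↭DE′ i∈S) full₃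
        (λ j∈E′ → trans (ev₃ .untouched (∈.∈-++⁺ˡ j∈E′))
          (trans (ev₂′ .untouched (∈.∈-++⁺ˡ j∈E′))
            (trans (ev₂ .untouched (∈.∈-++⁺ˡ j∈E′)) (full₁ (↭.∈-resp-↭ (↭-sym S↭DE′) (∈.∈-++⁺ʳ D j∈E′)))))))
    , accounting {S} {D} {E′} {st} {st₁} {proj₂ st₂} {proj₂ st₂′} {st₃} {H = proj₁ st₂} S↭DE′ acc₁
        (λ {j} n → subst (λ x → seq (accepted x j) n ℚ.≤ seq (acceptedIn st₁ j) n) forget₂
          (accepted-idle (d ℕ.* B) (forget st₁) j n))
        (ev₁₂ .rate {S} {E} SE↭)
        (subst (λ x → seq (∑ S (loadAt x)) ≲ (λ n → ι K * seq (∑ D (loadAt x)) n + ρ)) forget₂ heavy)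
        acc₃
        (λ j∈E′ n → ℚ.≤-trans (ev₃ .accepts (∈.∈-++⁺ˡ j∈E′) n) (ev₂′ .accepts (∈.∈-++⁺ˡ j∈E′) n))
    where
    d = K ℕ.^ k ℕ.* u
    DE↭ : D ++ (E′ ++ E) ↭ allFin m
    DE↭ = split↭ {S} {E} {D} {E′} SE↭ S↭DE′
    fullD : Full D st₁
    fullD i∈D = full₁ (↭.∈-resp-↭ (↭-sym S↭DE′) (∈.∈-++⁺ˡ i∈D))
    st₂ st₂′ : State
    st₂ = drain D st₁
    st₂′ = refill D st₂
    ev₂ : Evolves (E′ ++ E) (d ℕ.* B) st₁ st₂
    ev₂ = subst (λ l → Evolves (E′ ++ E) (l ℕ.* B) st₁ st₂) |D| (drain-evolves {D} {E′ ++ E} DE↭ fullD)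
    ev₂′ : Evolves (E′ ++ E) 0 st₂ st₂′
    ev₂′ = refill-evolves {D} {E′ ++ E} DE↭ (drain-queue D st₁ (split-unique {D = D} {E′ ++ E} DE↭ .proj₁) fullD)
    forget₂ : idle (d ℕ.* B) (forget st₁) ≡ forget st₂
    forget₂ = sym (trans (drain-forget D st₁) (cong (λ l → idle (l ℕ.* B) (forget st₁)) |D|))
    ev₁₂ : Evolves E (time k (K ℕ.* u) ℕ.+ d ℕ.* B) st st₂
    ev₁₂ = evolves-trans {E} {time k (K ℕ.* u)} {d ℕ.* B} ev₁ (evolves-⊇ {E} {E′ ++ E} (∈.∈-++⁺ʳ E′) ev₂)
    full′ : ∀ st {i} → i ∈ D ++ E′ → Full D st → Full E′ st → queueOf st i ≡ B
    full′ st i∈DE′ fullD fullE′ = [ fullD , fullE′ ]′ (∈.∈-++⁻ D i∈DE′)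

  -- Induction on `k` with `u` varying: the first attack regards `S` as K ^ k * (K * u) buffers, the
  -- second is directed at a block of K ^ k * u.
  play : ∀ k u {S E} → S ++ E ↭ allFin m → length S ≡ K ℕ.^ k ℕ.* u →
         ∀ τ → 0ℚ ℚ.< τ → ∀ st → Full S st →
         ∃[ st′ ] Played k u S E τ st st′
  play zero u {S} SE↭ |S| τ 0<τ st full = st , evolves-refl , full , ≤⇒≲ λ n → begin
    seq (∑ S (acceptedIn st)) n                                    ≡⟨ ∑-+ S (loadAt (forget st)) (sentIn st) n ⟩
    seq (∑ S (loadAt (forget st))) n + seq (∑ S (sentIn st)) n     ≤⟨ ℚ.+-monoˡ-≤ _ (∑load≤ S (forget st) n) ⟩
    ι (length S ℕ.* B) + seq (∑ S (sentIn st)) n                   ≡⟨ ℚ.+-comm (ι (length S ℕ.* B)) _ ⟩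
    seq (∑ S (sentIn st)) n + ι (length S ℕ.* B)
      ≡⟨ cong (λ l → seq (∑ S (sentIn st)) n + ι (l ℕ.* B))
                                                                       (trans |S| (ℕ.*-identityˡ u)) ⟩
    seq (∑ S (sentIn st)) n + ι (u ℕ.* B)
      ≤⟨ ℚ.+-monoʳ-≤ (seq (∑ S (sentIn st)) n) (p≤p+q _ (ℚ.<⇒≤ 0<τ)) ⟩
    seq (∑ S (sentIn st)) n + (ι (u ℕ.* B) + τ)                    ∎
    where open ℚ.≤-Reasoning
  play (suc k) u {S} {E} SE↭ |S| τ 0<τ st full =
    let d = K ℕ.^ k ℕ.* u
        0<½τ = half-pos 0<τ
        st₁ , played₁ = play k (K ℕ.* u) {S} {E} SE↭ (trans |S| size) (τ * ½) 0<½τ st full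
        -- The loads are those after the wait. By `drain-forget` they are determined before `D` is.
        D , E′ , S↭DE′ , |D| , heavy = heaviest-block (loadAt (idle (d ℕ.* B) (forget st₁))) (suc c) d S
                                         (trans |S| (ℕ.*-assoc K (K ℕ.^ k) u)) (τ * ½) 0<½τ
        st₃ , played₃ = play k u {D} {E′ ++ E} (split↭ {S} {E} {D} {E′} SE↭ S↭DE′) |D| (τ * ½) 0<½τ
                          (refill D (drain D st₁)) (λ {i} → refill-full D (drain D st₁) {i})
    -- The errors of first attack, block choice and second attack are `τ * ½` each and enter
    -- `combine` with weights 1 - η, η and 1, so they add up to `τ`.
    in st₃ , subst (λ τ → Played (suc k) u S E τ st st₃) (half+half τ)
               (play-round k u {S} {E} {D} {E′} (τ * ½) SE↭ S↭DE′ |D| played₁ heavy played₃)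
    where
    size : K ℕ.^ suc k ℕ.* u ≡ K ℕ.^ k ℕ.* (K ℕ.* u)
    size = trans (cong (ℕ._* u) (ℕ.*-comm K (K ℕ.^ k))) (ℕ.*-assoc (K ℕ.^ k) K u)

-- Closed forms of the recursions

module Closed (B c : ℕ) where

  open Rounds B c

  -- Once the time for emptying all K ^ k * u buffers is added, each level multiplies by 1 + K. The
  -- sum is also what the offline schedule sends in the end.
  time-closed : ∀ k u → time k u ℕ.+ K ℕ.^ k ℕ.* u ℕ.* B ≡ suc K ℕ.^ k ℕ.* u ℕ.* B
  time-closed zero    u = refl
  time-closed (suc k) u = begin
    t ℕ.+ Q ℕ.* u ℕ.* B ℕ.+ t′ ℕ.+ (K ℕ.* Q) ℕ.* u ℕ.* B
      ≡⟨ Sℕ.solve 6 (λ t t′ Q κ u b → t Sℕ.:+ Q Sℕ.:* u Sℕ.:* b Sℕ.:+ t′ Sℕ.:+ (κ Sℕ.:* Q) Sℕ.:* u Sℕ.:* b Sℕ.:=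
           (t Sℕ.:+ Q Sℕ.:* (κ Sℕ.:* u) Sℕ.:* b) Sℕ.:+ (t′ Sℕ.:+ Q Sℕ.:* u Sℕ.:* b)) refl t t′ Q K u B ⟩
    (t ℕ.+ Q ℕ.* (K ℕ.* u) ℕ.* B) ℕ.+ (t′ ℕ.+ Q ℕ.* u ℕ.* B)
      ≡⟨ cong₂ ℕ._+_ (time-closed k (K ℕ.* u)) (time-closed k u) ⟩
    P ℕ.* (K ℕ.* u) ℕ.* B ℕ.+ P ℕ.* u ℕ.* B
      ≡⟨ Sℕ.solve 4 (λ P κ u b → P Sℕ.:* (κ Sℕ.:* u) Sℕ.:* b Sℕ.:+ P Sℕ.:* u Sℕ.:* b Sℕ.:=
           ((Sℕ.con 1 Sℕ.:+ κ) Sℕ.:* P) Sℕ.:* u Sℕ.:* b) refl P K u B ⟩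
    (suc K ℕ.* P) ℕ.* u ℕ.* B ∎
    where
    open ≡-Reasoning
    t = time k (K ℕ.* u)
    t′ = time k u
    Q = K ℕ.^ k
    P = suc K ℕ.^ k

  -- In units of the capacity of the K ^ k * u attacked buffers this is (1 + 1/K)^k - k η (1 - η),
  -- so by `time-closed` it exceeds the time by 1 - k η (1 - η).
  bound-closed : ∀ k u → bound k u ≡ ι (u ℕ.* B) * (ι (suc K ℕ.^ k) - (ι k * (η * (1ℚ - η))) * ι (K ℕ.^ k))
  bound-closed zero    u = trans
    (S.solve 2 (λ x h → x S.:= x S.:* (S.con 1ℚ S.:- (S.con 0ℚ S.:* (h S.:* (S.con 1ℚ S.:- h))) S.:* S.con 1ℚ)) refl (ι (u ℕ.* B)) η)
    (cong₂ (λ i z → ι (u ℕ.* B) * (i - (z * (η * (1ℚ - η))) * i)) (sym ι-1) (sym ι-0))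
  bound-closed (suc k) u = begin
    (1ℚ - η) * bound k (K ℕ.* u) + η * ι (t ℕ.+ Q ℕ.* u ℕ.* B) + bound k u
      ≡⟨ cong₂ (λ x y → (1ℚ - η) * x + η * ι (t ℕ.+ Q ℕ.* u ℕ.* B) + y) (bound-closed k (K ℕ.* u)) (bound-closed k u) ⟩
    (1ℚ - η) * (ι (K ℕ.* u ℕ.* B) * (p - (ι k * (η * (1ℚ - η))) * q)) + η * ι (t ℕ.+ Q ℕ.* u ℕ.* B)
      + β * (p - (ι k * (η * (1ℚ - η))) * q)
      ≡⟨ cong₂ (λ x y → (1ℚ - η) * (x * (p - (ι k * (η * (1ℚ - η))) * q)) + η * y + β * (p - (ι k * (η * (1ℚ - η))) * q)) ιKuB ιt ⟩
    (1ℚ - η) * ((ι K * β) * (p - (ι k * (η * (1ℚ - η))) * q)) + η * (p * (ι K * β) - q * (ι K * β) + q * β)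
      + β * (p - (ι k * (η * (1ℚ - η))) * q)
      ≡⟨ S.solve 6 (λ h b p q x κ →
           (S.con 1ℚ S.:- h) S.:* ((κ S.:* b) S.:* (p S.:- (x S.:* (h S.:* (S.con 1ℚ S.:- h))) S.:* q))
             S.:+ h S.:* (p S.:* (κ S.:* b) S.:- q S.:* (κ S.:* b) S.:+ q S.:* b)
             S.:+ b S.:* (p S.:- (x S.:* (h S.:* (S.con 1ℚ S.:- h))) S.:* q) S.:=
           b S.:* ((S.con 1ℚ S.:+ κ) S.:* p S.:- ((S.con 1ℚ S.:+ x) S.:* (h S.:* (S.con 1ℚ S.:- h))) S.:* (κ S.:* q))
             S.:+ (h S.:* κ S.:- S.con 1ℚ) S.:* (b S.:* ((x S.:* (h S.:* (S.con 1ℚ S.:- h))) S.:* q S.:- h S.:* q)))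
           refl η β p q (ι k) (ι K) ⟩
    β * ((1ℚ + ι K) * p - ((1ℚ + ι k) * (η * (1ℚ - η))) * (ι K * q))
      + (η * ι K - 1ℚ) * (β * ((ι k * (η * (1ℚ - η))) * q - η * q))
      ≡⟨ cong (λ w → β * ((1ℚ + ι K) * p - ((1ℚ + ι k) * (η * (1ℚ - η))) * (ι K * q)) + (w - 1ℚ) * (β * ((ι k * (η * (1ℚ - η))) * q - η * q))) η*K ⟩
    β * ((1ℚ + ι K) * p - ((1ℚ + ι k) * (η * (1ℚ - η))) * (ι K * q)) + 0ℚ * (β * ((ι k * (η * (1ℚ - η))) * q - η * q))
      ≡⟨ trans (cong (β * ((1ℚ + ι K) * p - ((1ℚ + ι k) * (η * (1ℚ - η))) * (ι K * q)) +_) (ℚ.*-zeroˡ (β * ((ι k * (η * (1ℚ - η))) * q - η * q)))) (ℚ.+-identityʳ _) ⟩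
    β * ((1ℚ + ι K) * p - ((1ℚ + ι k) * (η * (1ℚ - η))) * (ι K * q))
      ≡⟨ cong₂ (λ x y → β * (x - y))
           (trans (cong (_* p) (sym (ι-suc K))) (sym (ι-* (suc K) (suc K ℕ.^ k))))
           (cong₂ (λ x y → (x * (η * (1ℚ - η))) * y) (sym (ι-suc k)) (sym (ι-* K Q))) ⟩
    β * (ι (suc K ℕ.^ suc k) - (ι (suc k) * (η * (1ℚ - η))) * ι (K ℕ.^ suc k)) ∎
    where
    open ≡-Reasoning
    Q = K ℕ.^ k
    P = suc K ℕ.^ k
    t = time k (K ℕ.* u)
    p = ι P
    q = ι Q
    β = ι (u ℕ.* B)
    ιKuB : ι (K ℕ.* u ℕ.* B) ≡ ι K * β
    ιKuB = trans (cong ι (ℕ.*-assoc K u B)) (ι-* K (u ℕ.* B))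
    ι-*KuB : ∀ n → ι (n ℕ.* (K ℕ.* u) ℕ.* B) ≡ ι n * (ι K * β)
    ι-*KuB n = trans (cong ι (ℕ.*-assoc n (K ℕ.* u) B)) (trans (ι-* n (K ℕ.* u ℕ.* B)) (cong (ι n *_) ιKuB))
    ιt : ι (t ℕ.+ Q ℕ.* u ℕ.* B) ≡ p * (ι K * β) - q * (ι K * β) + q * β
    ιt = begin
      ι (t ℕ.+ Q ℕ.* u ℕ.* B)                              ≡⟨ ι-+ t (Q ℕ.* u ℕ.* B) ⟩
      ι t + ι (Q ℕ.* u ℕ.* B)
        ≡⟨ cong₂ _+_ (S.solve 2 (λ t z → t S.:= (t S.:+ z) S.:- z) refl (ι t) (q * (ι K * β)))
                                                               (trans (cong ι (ℕ.*-assoc Q u B)) (ι-* Q (u ℕ.* B))) ⟩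
      (ι t + q * (ι K * β)) - q * (ι K * β) + q * β
        ≡⟨ cong (λ x → (ι t + x) - q * (ι K * β) + q * β) (sym (ι-*KuB Q)) ⟩
      (ι t + ι (Q ℕ.* (K ℕ.* u) ℕ.* B)) - q * (ι K * β) + q * β ≡⟨ cong (λ x → x - q * (ι K * β) + q * β)
                                                               (trans (sym (ι-+ t (Q ℕ.* (K ℕ.* u) ℕ.* B)))
                                                                 (trans (cong ι (time-closed k (K ℕ.* u))) (ι-*KuB P))) ⟩
      p * (ι K * β) - q * (ι K * β) + q * β                ∎

  E : ℚ
  E = (1ℚ + η) ↑ K

  -- The unit of the calculation: the capacity of all K ^ K attacked buffers.
  weight : ℚ
  weight = ι (K ℕ.^ K ℕ.* B)

  optimum-closed : ι (suc K ℕ.^ K ℕ.* 1 ℕ.* B) ≡ weight * E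
  optimum-closed = begin
    ι (suc K ℕ.^ K ℕ.* 1 ℕ.* B)             ≡⟨ cong (λ x → ι (x ℕ.* B)) (ℕ.*-identityʳ (suc K ℕ.^ K)) ⟩
    ι (suc K ℕ.^ K ℕ.* B)                   ≡⟨ ι-* (suc K ℕ.^ K) B ⟩
    ι (suc K ℕ.^ K) * ι B                   ≡⟨ cong (_* ι B) (ι-↑ K (recip-inverse (ι K) 0<K) K) ⟩
    (E * ι (K ℕ.^ K)) * ι B
      ≡⟨ S.solve 3 (λ e q b → (e S.:* q) S.:* b S.:= (q S.:* b) S.:* e) refl E (ι (K ℕ.^ K)) (ι B) ⟩
    (ι (K ℕ.^ K) * ι B) * E                 ≡⟨ cong (_* E) (sym (ι-* (K ℕ.^ K) B)) ⟩
    weight * E                              ∎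
    where open ≡-Reasoning

  -- After K levels, η K = 1 reduces the excess to one `η`; the other `η` is the error granted to
  -- the block choices.
  bound-total : bound K 1 + weight * η ≡ weight * (E - 1ℚ + (η + η))
  bound-total = begin
    bound K 1 + weight * η
      ≡⟨ cong₂ (λ x w → x + w * η) (bound-closed K 1) (ι-* (K ℕ.^ K) B) ⟩
    ι (1 ℕ.* B) * (ι (suc K ℕ.^ K) - (ι K * (η * (1ℚ - η))) * q) + (q * ι B) * η
      ≡⟨ cong₂ (λ b p → ι b * (p - (ι K * (η * (1ℚ - η))) * q) + (q * ι B) * η) (ℕ.*-identityˡ B)
           (ι-↑ K (recip-inverse (ι K) 0<K) K) ⟩
    ι B * (E * q - (ι K * (η * (1ℚ - η))) * q) + (q * ι B) * η
      ≡⟨ S.solve 5 (λ b e q κ h → b S.:* (e S.:* q S.:- (κ S.:* (h S.:* (S.con 1ℚ S.:- h))) S.:* q) S.:+ (q S.:* b) S.:* h S.:=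
           (q S.:* b) S.:* (e S.:- (h S.:* κ) S.:* (S.con 1ℚ S.:- h) S.:+ h)) refl (ι B) E q (ι K) η ⟩
    (q * ι B) * (E - (η * ι K) * (1ℚ - η) + η)
      ≡⟨ cong₂ (λ w x → w * (E - x * (1ℚ - η) + η)) (sym (ι-* (K ℕ.^ K) B)) η*K ⟩
    weight * (E - 1ℚ * (1ℚ - η) + η)
      ≡⟨ S.solve 3 (λ w e h → w S.:* (e S.:- S.con 1ℚ S.:* (S.con 1ℚ S.:- h) S.:+ h) S.:=
           w S.:* (e S.:- S.con 1ℚ S.:+ (h S.:+ h))) refl weight E η ⟩
    weight * (E - 1ℚ + (η + η)) ∎
    where
    open ≡-Reasoning
    q = ι (K ℕ.^ K)

-- The complete input and its two throughputs

module Final {m B : ℕ} (c : ℕ) (1≤B : 1 ≤ B) (A : FractionalAlgorithm m B) where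

  open Offline {m} B
  open Draining {m} B
  open Online A
  open Rounds B c
  open Closed B c
  open Adversary c 1≤B A
  open Evolves

  start : List (Fin m) → State
  start S = refill S ([] , none)

  empty-queue : ∀ i → queueOf ([] , none) i ≡ 0
  empty-queue i = trans (cong (B ℕ.⊓_) (Vec.lookup-replicate i 0)) (ℕ.⊓-zeroʳ B)

  empty-feasible : Feasible ([] , none)
  empty-feasible = tt , λ i → subst (ℕ._≤ B) (sym (Vec.lookup-replicate i 0)) z≤n

  start-evolves : ∀ {S E} → S ++ E ↭ allFin m → Evolves E 0 ([] , none) (start S)
  start-evolves {S} {E} SE↭ = refill-evolves {S} {E} SE↭ (λ {i} _ → empty-queue i)

  empty-accepted : ∀ j n → seq (acceptedIn ([] , none) j) n ℚ.≤ 0ℚ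
  empty-accepted j n = ℚ.≤-trans
    (ℚ.≤-reflexive (ℚ.+-identityʳ _))
    (ℚ.≤-trans (ℚ.p⊓q≤q (ℤ.+ B ℚ./ 1) _)
      (ℚ.≤-reflexive (cong (λ k → 0ℚ + ℤ.+ k ℚ./ 1) (Vec.lookup-replicate j 0))))

  close : State → Script m
  close (H , p) = (p , nothing) ∷ H

  module _ {k S E} (SE↭ : S ++ E ↭ allFin m) (|S| : length S ≡ K ℕ.^ k ℕ.* 1)
           {τ st} (played : Played k 1 S E τ (start S) st) where

    evolves : Evolves E (time k 1) ([] , none) st
    evolves = evolves-trans {E} {0} {time k 1} {[] , none} {start S} {st} (start-evolves {S} {E} SE↭) (proj₁ played)

    full : Full S st
    full = proj₁ (proj₂ played)

    -- The offline schedule empties `S` after the attack, so that every packet is sent; `close`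
    -- turns the pending injection into a last, idle step.
    script-end : Script m
    script-end = close (drain S st)

    end-lossless : Lossless script-end
    end-lossless = drain-feasible S st (evolves .feasible empty-feasible)

    S! : Unique S
    S! = split-unique {D = S} {E} SE↭ .proj₁

    end-empty : ∀ i → queueOf (drain S st) i ≡ 0
    end-empty i = [ drain-queue S st S! full
                  , (λ i∈E → trans (drain-other S st i (split-unique {D = S} {E} SE↭ .proj₂ i∈E))
                      (trans (evolves .untouched i∈E) (empty-queue i))) ]′
      (∈.∈-++⁻ S (↭.∈-resp-↭ (↭-sym SE↭) (∈.∈-allFin i)))

    end-left : sum (leftAfter script-end) ≡ 0
    end-left = trans (sum-cong-≗ {m} {leftAfter script-end} {λ _ → 0} end-empty) (sum-replicate-zero m)

    end-sent : sentAfter script-end ≡ suc K ℕ.^ k ℕ.* 1 ℕ.* B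
    end-sent = begin
      sentAfter (proj₁ (drain S st)) ℕ.+ 0         ≡⟨ ℕ.+-identityʳ _ ⟩
      sentAfter (proj₁ (drain S st))               ≡⟨ drain-sent S st S! full ⟩
      sentAfter (proj₁ st) ℕ.+ length S ℕ.* B      ≡⟨ cong₂ (λ s l → s ℕ.+ l ℕ.* B) (evolves .sends) |S| ⟩
      time k 1 ℕ.+ K ℕ.^ k ℕ.* 1 ℕ.* B             ≡⟨ time-closed k 1 ⟩
      suc K ℕ.^ k ℕ.* 1 ℕ.* B                      ∎
      where open ≡-Reasoning

    end-optimum : IsOptimum B (inputOf script-end) (suc K ℕ.^ k ℕ.* 1 ℕ.* B)
    end-optimum = subst (IsOptimum B (inputOf script-end)) end-sent
      (optimum script-end B end-lossless end-left)

    end-packet : HasPacket (inputOf script-end)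
    end-packet = hasPacket script-end (begin-strict
      0
        <⟨ ℕ.*-mono-≤ (ℕ.*-mono-≤ (ℕ.m^n>0 (suc K) k) (ℕ.≤-refl {1})) 1≤B ⟩
      suc K ℕ.^ k ℕ.* 1 ℕ.* B                        ≡⟨ sym end-sent ⟩
      sentAfter script-end                           ≤⟨ ℕ.m≤m+n _ _ ⟩
      sentAfter script-end ℕ.+ sum (leftAfter script-end) ≡⟨ sent≡total script-end end-lossless ⟩
      total (map proj₁ script-end)                   ∎)
      where open ℕ.≤-Reasoning

    drained : ∀ j n → seq (acceptedIn (drain S st) j) n ℚ.≤ seq (acceptedIn st j) n
    drained j n = subst (λ x → seq (accepted x j) n ℚ.≤ seq (acceptedIn st j) n) (sym (drain-forget S st))
      (accepted-idle (length S ℕ.* B) (forget st) j n)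

    -- On `S` the bound of the attack persists, as emptying adds no packets and nothing had been
    -- sent at the start. The buffers in `E` never accept anything.
    end-accepted : seq (∑ (allFin m) (acceptedIn (drain S st))) ≲ (λ _ → bound k 1 + τ)
    end-accepted =
      ≲-trans (≡⇒≲ (λ n → trans (sym (∑-↭ SE↭ (acceptedIn (drain S st)) n)) (∑-++ S E (acceptedIn (drain S st)) n)))
        (≲-trans (≲-+ onS onE)
          (≡⇒≲ (λ n → trans (ℚ.+-identityʳ _)
            (trans (cong (_+ (bound k 1 + τ)) (∑-0 S n)) (ℚ.+-identityˡ (bound k 1 + τ))))))
      where
      onS : seq (∑ S (acceptedIn (drain S st))) ≲ (λ n → seq (∑ S (sentIn (start S))) n + (bound k 1 + τ))
      onS = ≲-trans (≤⇒≲ (λ n → ∑-mono-≤ S _ _ n (λ {j} _ → drained j n))) (proj₂ (proj₂ played))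
      onE : seq (∑ E (acceptedIn (drain S st))) ≲ (λ _ → 0ℚ)
      onE = ≲-trans
        (≤⇒≲ (λ n → ∑-mono-≤ E (acceptedIn (drain S st)) (λ _ → 0ᵣ) n
          (λ {j} j∈E → ℚ.≤-trans (drained j n) (ℚ.≤-trans (evolves .accepts j∈E n) (empty-accepted j n)))))
        (≡⇒≲ (∑-0 E))

    end-throughput : ∀ n → seq (transmitted A (inputOf script-end) n) ≲ (λ _ → bound k 1 + τ)
    end-throughput n =
      ≲-trans (transmitted≲ (inputOf script-end) n)
        (≲-trans (≡⇒≲ (λ i → cong (λ h → seq (∑ (allFin m) (accepted (h , none))) i) (past-inputOf script-end)))
          (≲-trans (≤⇒≲ (λ i → ∑-mono-≤ (allFin m) (accepted (map proj₁ script-end , none)) (acceptedIn (drain S st)) i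
                     (λ {j} _ → accepted-step (map proj₁ (proj₁ (drain S st))) (proj₂ (drain S st)) j i)))
            end-accepted))

  outcome : ∀ k → K ℕ.^ k ℕ.* 1 ≤ m → ∀ τ → 0ℚ ℚ.< τ →
    ∃[ σ ] (HasPacket σ × IsOptimum B σ (suc K ℕ.^ k ℕ.* 1 ℕ.* B) ×
            (∀ n → seq (transmitted A σ n) ≲ (λ _ → bound k 1 + τ)))
  outcome k N≤m τ 0<τ =
    let N = K ℕ.^ k ℕ.* 1
        S = take N (allFin m)
        E = drop N (allFin m)
        SE↭ : S ++ E ↭ allFin m
        SE↭ = ↭-reflexive (List.take++drop≡id N (allFin m))
        |S| : length S ≡ N
        |S| = trans (List.length-take N (allFin m))
                (trans (cong (N ℕ.⊓_) (List.length-tabulate id)) (ℕ.m≤n⇒m⊓n≡m N≤m))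
        st , played = play k 1 {S} {E} SE↭ |S| τ 0<τ (start S) (λ {i} → refill-full S ([] , none) {i})
    in inputOf (script-end {k} {S} {E} SE↭ |S| played)
     , end-packet {k} {S} {E} SE↭ |S| played
     , end-optimum {k} {S} {E} SE↭ |S| played
     , end-throughput {k} {S} {E} SE↭ |S| played

-- Choice of K and passage to e / (e - 1)

theorem12 : (B : ℕ) → 1 ≤ B → (ε : ℝ) → 0ᵣ <ᵣ ε →
    ∃[ m₀ ] ((m : ℕ) → m₀ ≤ m → (A : FractionalAlgorithm m B) → CompetitiveRatio≥ A (e/[e-1] -ᵣ ε))
theorem12 B 1≤B ε (ε₀ , 0<ε₀ , N₀ , ε₀≤ε) = K ℕ.^ K ℕ.* 1 , λ m m₀≤m A q (δ , 0<δ , N₁ , q≤) →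
  let σ , packet , opt , throughput = Final.outcome c 1≤B A K m₀≤m (weight * η) (*-pos 0<weight 0<η)
  in σ , packet , fromℚ x , suc K ℕ.^ K ℕ.* 1 ℕ.* B
   , (λ n → _≲_.within (≲-trans (throughput n) (≡⇒≲ (λ _ → bound-total))))
   , opt
   -- Past `N₀` the terms of `ε` are at least `ε₀`, past `N₁` the hypothesis on `q` holds termwise,
   -- and from `suc K` on the partial sums of e are at least `E`.
   , (weight * gap , *-pos 0<weight 0<gap , N₀ ℕ.⊔ N₁ ℕ.⊔ suc K
     , λ n ≤n → exceeds (seq q n) n (ℕ.m⊔n≤o⇒n≤o (N₀ ℕ.⊔ N₁) (suc K) ≤n)
         (weaken {seq q n} {y = expSum n * recip (expSum n - 1ℚ)} (ℚ.<⇒≤ 0<δ) (ε₀≤ε n (ℕ.m⊔n≤o⇒m≤o N₀ N₁ (ℕ.m⊔n≤o⇒m≤o (N₀ ℕ.⊔ N₁) (suc K) ≤n)))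
           (q≤ n (ℕ.m⊔n≤o⇒n≤o N₀ N₁ (ℕ.m⊔n≤o⇒m≤o (N₀ ℕ.⊔ N₁) (suc K) ≤n)))))
  where
  d c : ℕ
  d = proj₁ (unit-fraction-below ε₀ 0<ε₀)
  -- This makes K equal to 4 (d + 1), so that 4 η = 1 / (d + 1) lies below `ε₀`.
  c = 2 ℕ.+ 4 ℕ.* d
  open Rounds B c
  open Closed B c

  4η gap x : ℚ
  4η = (η + η) + (η + η)
  gap = ε₀ - 4η
  x = weight * (E - 1ℚ + (η + η))

  4η≡ : 4η ≡ ℤ.+ 1 ℚ./ suc d
  4η≡ = begin
    4η
      ≡⟨ S.solve 1 (λ h → (h S.:+ h) S.:+ (h S.:+ h) S.:= ((S.con 1ℚ S.:+ S.con 1ℚ) S.:* (S.con 1ℚ S.:+ S.con 1ℚ)) S.:* h S.:* S.con 1ℚ) refl η ⟩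
    ((1ℚ + 1ℚ) * (1ℚ + 1ℚ)) * η * 1ℚ
      ≡⟨ cong (((1ℚ + 1ℚ) * (1ℚ + 1ℚ)) * η *_) (sym (ι-unit-fraction (suc d))) ⟩
    ((1ℚ + 1ℚ) * (1ℚ + 1ℚ)) * η * (ι (suc d) * u)
      ≡⟨ S.solve 3 (λ h i u → ((S.con 1ℚ S.:+ S.con 1ℚ) S.:* (S.con 1ℚ S.:+ S.con 1ℚ)) S.:* h S.:* (i S.:* u) S.:=
                                                  (h S.:* (((S.con 1ℚ S.:+ S.con 1ℚ) S.:* (S.con 1ℚ S.:+ S.con 1ℚ)) S.:* i)) S.:* u) refl η (ι (suc d)) u ⟩
    (η * (((1ℚ + 1ℚ) * (1ℚ + 1ℚ)) * ι (suc d))) * u ≡⟨ cong (λ z → (η * z) * u) (sym ιK) ⟩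
    (η * ι K) * u                            ≡⟨ cong (_* u) η*K ⟩
    1ℚ * u                                   ≡⟨ ℚ.*-identityˡ u ⟩
    u                                        ∎
    where
    open ≡-Reasoning
    u = ℤ.+ 1 ℚ./ suc d
    ιK : ι K ≡ ((1ℚ + 1ℚ) * (1ℚ + 1ℚ)) * ι (suc d)
    ιK = trans (cong ι (sym (ℕ.*-suc 4 d)))
      (trans (ι-* 4 (suc d)) (cong (_* ι (suc d))
        (trans (ι-* 2 2) (cong₂ _*_ ι-2 ι-2))))
      where
      ι-2 : ι 2 ≡ 1ℚ + 1ℚ
      ι-2 = trans (ι-+ 1 1) (cong₂ _+_ ι-1 ι-1)

  0<gap : 0ℚ ℚ.< gap
  0<gap = subst (ℚ._< gap) (ℚ.+-inverseʳ 4η)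
    (ℚ.+-monoˡ-< (ℚ.- 4η) (subst (ℚ._< ε₀) (sym 4η≡) (proj₂ (unit-fraction-below ε₀ 0<ε₀))))

  0<weight : 0ℚ ℚ.< weight
  0<weight = 0<ι (ℕ.*-mono-≤ (ℕ.m^n>0 K K) 1≤B)

  -- This is `ratio` multiplied by `weight`, with the partial sum `expSum n` in the role of e.
  exceeds : ∀ z n → suc K ≤ n → z ℚ.≤ expSum n * recip (expSum n - 1ℚ) - ε₀ →
            z * x + weight * gap ℚ.≤ ℤ.+ (suc K ℕ.^ K ℕ.* 1 ℕ.* B) ℚ./ 1
  exceeds z n K<n z≤ = subst₂ ℚ._≤_
    (S.solve 4 (λ w z y g → w S.:* (z S.:* y S.:+ g) S.:= z S.:* (w S.:* y) S.:+ w S.:* g) refl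
      weight z (E - 1ℚ + (η + η)) gap)
    (trans (sym optimum-closed) (ι-def (suc K ℕ.^ K ℕ.* 1 ℕ.* B)))
    (*-monoˡ weight (ℚ.<⇒≤ 0<weight)
      (ratio (2≤expSum (ℕ.≤-trans (s≤s (s≤s z≤n)) K<n))
        (2≤compound (suc c) (ℚ.<⇒≤ 0<η) (recip-inverse (ι K) 0<K))
        (compound≤e K (ℚ.<⇒≤ 0<η) (recip-inverse (ι K) 0<K) K<n)
        (ℚ.<⇒≤ 0<η) (ℚ.<⇒≤ 0<ε₀) z≤))

  weaken : ∀ {z δ y ε′} → 0ℚ ℚ.≤ δ → 0ℚ + ε₀ ℚ.≤ ε′ → z + δ ℚ.≤ y - ε′ → z ℚ.≤ y - ε₀
  weaken {z} {y = y} 0≤δ ε₀≤ z≤ = ℚ.≤-trans (p≤p+q z 0≤δ) (ℚ.≤-trans z≤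
    (ℚ.+-monoʳ-≤ y (ℚ.neg-antimono-≤ (subst (ℚ._≤ _) (ℚ.+-identityˡ ε₀) ε₀≤))))
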